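{- For every $n\ge 2$ the path $P_n$ on $n$ vertices is eligible, and $\operatorname{mv}(P_n)\to 2$ as $n \to \infty$.
   Context: Graphs are finite and simple. For a graph $G$ on $n$ vertices, $\mathcal{S}_L(G)$ denotes the set of $n\times n$ real symmetric matrices $A=[a_{i,j}]$ such that $a_{i,j}<0$ if $\{i,j\}\in E(G)$, $a_{i,j}=0$ if $i\neq j$ and $\{i,j\}\notin E(G)$, and $a_{i,i}=-\sum_{k\neq i}a_{i,k}$ for all $i$. Let $\mathcal{S}^s_L(G)=\{A\in\mathcal{S}_L(G):\operatorname{tr}(A)=2|E(G)|\}$. For $A\in\mathcal{S}_L(G)$ with spectrum $\{0,\lambda_2,\ldots,\lambda_n\}$ put $\mathbb{E}(A)=\frac{1}{n-1}\sum_{i=2}^n\lambda_i$ and $\operatorname{Var}(A)=\frac{1}{n-1}\sum_{i=2}^n(\lambda_i-\mathbb{E}(A))^2$. The minimum variance of $G$ is $\operatorname{mv}(G)=\inf\{\operatorname{Var}(A):A\in\mathcal{S}^s_L(G)\}$. The line graph of $G$ has vertex set $E(G)$, two distinct edges being adjacent when they share a vertex. Let $M_2=4I+B$, where $B$ is the adjacency matrix of the line graph of $G$ ($M_2$ is positive definite). $G$ is called eligible if $M_2^{ -1}\mathbf{1}$ is entrywise positive, where $\mathbf{1}$ is the all-ones vector. -}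

module Defs where

open import Algebra.Bundles using (CommutativeRing)
import Algebra.Properties.CommutativeMonoid.Sum as CommutativeMonoidSum
import Algebra.Properties.Semiring.Exp as SemiringExp
import Algebra.Properties.Semiring.Mult as SemiringMult
import Algebra.Properties.Semiring.Sum as SemiringSum
open import Data.Bool.Base using (if_then_else_)
open import Data.Fin.Base using (Fin; zero; suc; toℕ; punchIn)
import Data.Fin.Properties as Fin
open import Data.List.Base using (List; length; filter; cartesianProduct; allFin; lookup)
open import Data.Nat.Base as ℕ using (ℕ; zero; suc)
import Data.Nat.Properties as ℕ
open import Data.Product.Base using (Σ-syntax; ∃-syntax; _×_; _,_)
open import Data.Sum.Base using (_⊎_; inj₁; inj₂; swap)
open import Data.Vec.Functional using (Vector; _∷_)
open import Level using (0ℓ)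
open import Relation.Binary.Core using (Rel)
open import Relation.Binary.Definitions using (Symmetric; Irreflexive; Decidable)
open import Relation.Binary.PropositionalEquality using (_≡_; _≢_; refl; sym; ≢-sym)
open import Relation.Binary.Structures using (IsStrictTotalOrder)
import Relation.Binary.Construct.StrictToNonStrict as StrictToNonStrict
open import Relation.Nullary using (¬_; does)
open import Relation.Nullary.Decidable using (_⊎-dec_; _×-dec_; ¬?)

-- The real numbers enter as an arbitrary Dedekind-complete ordered field, which
-- classically is ℝ up to unique isomorphism.
record CompleteOrderedField : Set₁ where
  field
    commutativeRing : CommutativeRing 0ℓ 0ℓ

  open CommutativeRing commutativeRing public

  infix 4 _<_
  infix 8 _⁻¹

  field
    _<_                : Rel Carrier 0ℓ
    isStrictTotalOrder : IsStrictTotalOrder _≈_ _<_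
    -- The inverse is total; its value at 0# is unspecified.
    _⁻¹                : Carrier → Carrier
    ⁻¹-inverseʳ        : ∀ x → ¬ x ≈ 0# → x * x ⁻¹ ≈ 1#
    0≉1                : ¬ 0# ≈ 1#
    +-monoˡ-<          : ∀ {x y} z → x < y → x + z < y + z
    *-pos              : ∀ {x y} → 0# < x → 0# < y → 0# < x * y

  open StrictToNonStrict _≈_ _<_ public using (_≤_)

  LowerBound : (Carrier → Set) → Carrier → Set
  LowerBound P b = ∀ x → P x → b ≤ x

  -- The second component is "no y greater than m is a lower bound", with the
  -- element below y given explicitly.
  IsInfimum : (Carrier → Set) → Carrier → Set
  IsInfimum P m = LowerBound P m × (∀ y → m < y → ∃[ x ] (P x × x < y))

  -- Because infima are approached by explicit elements, `infimum` yields
  -- excluded middle for types in Set: the reals here are the classical ones.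
  field
    infimum : (P : Carrier → Set) → ∃[ x ] P x → ∃[ b ] LowerBound P b →
              ∃[ m ] IsInfimum P m

record Graph (n : ℕ) : Set₁ where
  field
    Adj    : Rel (Fin n) 0ℓ
    adj?   : Decidable Adj
    symm   : Symmetric Adj
    irrefl : Irreflexive _≡_ Adj

open Graph public

-- An edge {i , j} is listed once, as the pair (i , j) with i < j.
edges : ∀ {n} → Graph n → List (Fin n × Fin n)
edges {n} G =
  filter (λ (i , j) → (i Fin.<? j) ×-dec adj? G i j)
         (cartesianProduct (allFin n) (allFin n))

size : ∀ {n} → Graph n → ℕ
size G = length (edges G)

_∈ₑ_ : ∀ {n} → Fin n → Fin n × Fin n → Set
v ∈ₑ (i , j) = v ≡ i ⊎ v ≡ j

ShareVertex : ∀ {n} → Rel (Fin n × Fin n) 0ℓ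
ShareVertex {n} e f = ∃[ v ] (v ∈ₑ e × v ∈ₑ f)

shareVertex? : ∀ {n} → Decidable (ShareVertex {n})
shareVertex? (i , j) (k , l) = Fin.any? λ v →
  ((v Fin.≟ i) ⊎-dec (v Fin.≟ j)) ×-dec ((v Fin.≟ k) ⊎-dec (v Fin.≟ l))

-- Vertices of the line graph are positions in the list of edges, which has no
-- repetitions.
lineGraph : ∀ {n} (G : Graph n) → Graph (size G)
lineGraph G = record
  { Adj    = λ a b → a ≢ b × ShareVertex (lookup (edges G) a) (lookup (edges G) b)
  ; adj?   = λ a b → ¬? (a Fin.≟ b) ×-dec
                     shareVertex? (lookup (edges G) a) (lookup (edges G) b)
  ; symm   = λ (a≢b , v , v∈e , v∈f) → ≢-sym a≢b , v , v∈f , v∈e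
  ; irrefl = λ a≡b (a≢b , _) → a≢b a≡b
  }

path : ∀ n → Graph n
path n = record
  { Adj    = λ i j → suc (toℕ i) ≡ toℕ j ⊎ suc (toℕ j) ≡ toℕ i
  ; adj?   = λ i j → (suc (toℕ i) ℕ.≟ toℕ j) ⊎-dec (suc (toℕ j) ℕ.≟ toℕ i)
  ; symm   = swap
  ; irrefl = λ { refl (inj₁ eq) → ℕ.1+n≢n eq ; refl (inj₂ eq) → ℕ.1+n≢n eq }
  }

module OverReals (ℝ : CompleteOrderedField) where

  open CompleteOrderedField ℝ hiding (zero)
  open SemiringSum semiring using (sum; sum-syntax)
  open CommutativeMonoidSum *-commutativeMonoid using () renaming (sum to product)
  open SemiringMult semiring using () renaming (_×_ to _·_)
  open SemiringExp semiring using (_^_)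

  fromℕ : ℕ → Carrier
  fromℕ n = n · 1#

  Matrix : ℕ → Set
  Matrix n = Fin n → Fin n → Carrier

  identity : ∀ {n} → Matrix n
  identity i j = if does (i Fin.≟ j) then 1# else 0#

  _⊡_ : ∀ {n} → Matrix n → Matrix n → Matrix n
  _⊡_ {n} A B i j = ∑[ k < n ] (A i k * B k j)

  _⊡ᵥ_ : ∀ {n} → Matrix n → Vector Carrier n → Vector Carrier n
  _⊡ᵥ_ {n} A v i = ∑[ k < n ] (A i k * v k)

  trace : ∀ {n} → Matrix n → Carrier
  trace {n} A = ∑[ i < n ] A i i

  -- Laplace expansion along the first row.
  det : ∀ {n} → Matrix n → Carrier
  det {zero}  A = 1#
  det {suc n} A =
    ∑[ j < suc n ] ((- 1#) ^ toℕ j * (A zero j * det (λ i k → A (suc i) (punchIn j k))))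

  -- The entries of μ are the eigenvalues of A with multiplicity: the
  -- characteristic polynomial det (tI - A) is ∏ᵢ (t - μᵢ).  Over an infinite
  -- field, polynomials agree as soon as they agree at every t.
  IsSpectrum : ∀ {n} → Matrix n → Vector Carrier n → Set
  IsSpectrum A μ =
    ∀ t → det (λ i j → t * identity i j - A i j) ≈ product (λ i → t - μ i)

  IsInverse : ∀ {n} → Matrix n → Matrix n → Set
  IsInverse A N = (∀ i j → (A ⊡ N) i j ≈ identity i j)
                × (∀ i j → (N ⊡ A) i j ≈ identity i j)

  adjacencyMatrix : ∀ {n} → Graph n → Matrix n
  adjacencyMatrix G i j = if does (adj? G i j) then 1# else 0#

  M₂ : ∀ {n} (G : Graph n) → Matrix (size G)
  M₂ G i j = fromℕ 4 * identity i j + adjacencyMatrix (lineGraph G) i j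

  Eligible : ∀ {n} → Graph n → Set
  Eligible G = Σ[ N ∈ Matrix (size G) ]
    (IsInverse (M₂ G) N × (∀ e → 0# < (N ⊡ᵥ (λ _ → 1#)) e))

  record InSL {n} (G : Graph n) (A : Matrix n) : Set where
    field
      symmetric : ∀ i j → A i j ≈ A j i
      edge      : ∀ i j → Adj G i j → A i j < 0#
      non-edge  : ∀ i j → i ≢ j → ¬ Adj G i j → A i j ≈ 0#
      diagonal  : ∀ i →
        A i i ≈ - (∑[ k < n ] (if does (k Fin.≟ i) then 0# else A i k))

  InSLˢ : ∀ {n} → Graph n → Matrix n → Set
  InSLˢ G A = InSL G A × trace A ≈ fromℕ (2 ℕ.* size G)

  mean : ∀ {k} → Vector Carrier k → Carrier
  mean {k} xs = fromℕ k ⁻¹ * sum xs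

  variance : ∀ {k} → Vector Carrier k → Carrier
  variance {k} xs =
    fromℕ k ⁻¹ * ∑[ i < k ] ((xs i - mean xs) * (xs i - mean xs))

  -- v = Var(A) for a matrix A on n = suc k vertices: λs lists λ₂, …, λₙ, so the
  -- averages in `variance` are over n - 1 = k values.
  IsVar : ∀ {k} → Matrix (suc k) → Carrier → Set
  IsVar {k} A v = Σ[ λs ∈ Vector Carrier k ] (IsSpectrum A (0# ∷ λs) × v ≈ variance λs)

  IsMv : ∀ {k} → Graph (suc k) → Carrier → Set
  IsMv {k} G = IsInfimum λ v → Σ[ A ∈ Matrix (suc k) ] (InSLˢ G A × IsVar A v)

  _⟶_ : (ℕ → Carrier) → Carrier → Set
  x ⟶ l = ∀ ε → 0# < ε →
    ∃[ N ] (∀ n → N ℕ.≤ n → l - ε < x n × x n < l + ε)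

{-# OPTIONS --safe #-}
-- For a weighted Laplacian A of the path with n = m + 1 vertices and trace 2m, the
-- sum of the squared eigenvalues is tr A² = ∑ aᵢ² + 2 ∑ wₑ², where aᵢ are the
-- diagonal entries and wₑ the weights, and Var(A) = (tr A² - 4m) / m.  Since
-- ∑ aᵢ = 2m and ∑ wₑ = m, expanding ∑ (aᵢ - 2)² + 2 ∑ (wₑ - 1)² ≥ 0 gives
-- tr A² ≥ 6m - 4, while unit weights attain tr A² = 6m - 2.  Hence
-- 2 - 4/m ≤ mv(Pₙ) ≤ 2 - 2/m.
--
-- The power sums of a spectrum are read off the characteristic polynomial at
-- infinity.  That unit weights have a spectrum at all amounts to a Chebyshev
-- polynomial splitting into linear factors; a Darboux transformation at the
-- largest root reduces this to a Jacobi matrix of smaller size.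
--
-- The line graph of the path is a path, so M₂ is tridiagonal and strictly
-- diagonally dominant, and Gaussian elimination inverts it with explicit bounds.
module Submission where

open import Algebra.Bundles using (CommutativeRing)
import Algebra.Properties.CommutativeMonoid.Sum as CommutativeMonoidSum
import Algebra.Properties.Ring as RingProperties
import Algebra.Properties.Semiring.Exp as SemiringExp
import Algebra.Properties.Semiring.Mult as SemiringMult
import Algebra.Properties.Semiring.Mult.TCOptimised as SemiringMult′
import Algebra.Properties.Semiring.Sum as SemiringSum
import Algebra.Solver.Ring as RingSolver
open import Algebra.Solver.Ring.AlmostCommutativeRing
  using (fromCommutativeRing; _-Raw-AlmostCommutative⟶_)
open import Data.Bool.Base using (if_then_else_)
open import Data.Bool.Properties using (∨-comm)
open import Data.Fin.Base as Fin using (Fin; zero; suc; toℕ; inject₁; punchIn)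
import Data.Fin.Properties as Fin
open import Data.Integer.Base as ℤ using (ℤ; +_; -[1+_])
import Data.Integer.Properties as ℤ
open import Data.Maybe.Base using (Maybe; just; nothing)
open import Data.Nat.Base as ℕ using (ℕ; zero; suc)
import Data.Nat.Properties as ℕ
open import Data.Product.Base using (Σ-syntax; ∃-syntax; _×_; _,_; proj₁; proj₂)
open import Data.Sum.Base using (_⊎_; inj₁; inj₂; [_,_]′)
import Data.Vec.Functional as Vec
open Vec using (Vector)
open import Function.Bundles using (_⇔_; mk⇔)
open import Level using (0ℓ)
import Relation.Binary.Construct.StrictToNonStrict as StrictToNonStrict
open import Relation.Binary.Definitions using (tri<; tri≈; tri>)
open import Relation.Binary.PropositionalEquality as ≡ using (_≡_; _≢_)
import Relation.Binary.Reasoning.Setoid as SetoidReasoning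
open import Relation.Binary.Structures using (IsStrictTotalOrder; IsTotalOrder)
open import Relation.Nullary using (¬_; Dec; yes; no; does; contradiction)
open import Relation.Nullary.Decidable using (_×-dec_; does-⇔)
open import Defs

-- A spectrum is given here only as a list of numbers whose product polynomial agrees with
-- `det (tI - A)` at every `t`; no diagonalisation comes with it. Hence the moments are taken from
-- the two leading asymptotic coefficients, which the three-term recurrence of a tridiagonal matrix
-- computes.
--
-- For the lower bound on the variance the spectrum is supplied, but for the upper bound one must be
-- produced. The eigenvalues 2 - 2cos(kπ/n) would call for trigonometry, so completeness enters
-- through an intermediate value theorem instead. Finding only the largest root and dividing it out
-- avoids separating the roots, as long as the quotient stays in the same class; the Darboux
-- transformation guarantees this, because it gives the quotient a three-term recurrence with
-- positive coefficients.
--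
-- The subtracted constants 2 and 1 are the interior diagonal entry and the weight of the unit path.
-- There only the squares of the two end vertices survive, and their sum 2 is the gap between 6m - 4
-- and 6m - 2. Divided by m it tends to 0, so the limit follows without locating the minimiser.

-- The ring solver cancels only coefficients whose equality it can decide, hence ℤ
-- rather than the ring itself.
module IntegerCoefficients (R : CommutativeRing 0ℓ 0ℓ) where
  open CommutativeRing R hiding (zero)
  open RingProperties ring
  open SemiringMult′ semiring using (×1-homo-*)
    renaming (_×_ to _×′_; ×-homo-+ to ×′-homo-+; 1+× to 1+×′)
  open SetoidReasoning setoid

  ⟦_⟧ℤ : ℤ → Carrier
  ⟦ + n ⟧ℤ      = n ×′ 1#
  ⟦ -[1+ n ] ⟧ℤ = - (suc n ×′ 1#)

  +-cancel-suc : ∀ a b → (1# + a) + - (1# + b) ≈ a + - b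
  +-cancel-suc a b = begin
    (1# + a) + - (1# + b)   ≈⟨ +-cong (+-comm 1# a) (sym (-‿+-comm 1# b)) ⟩
    (a + 1#) + (- 1# + - b) ≈⟨ +-assoc a 1# _ ⟩
    a + (1# + (- 1# + - b)) ≈⟨ +-congˡ (+-assoc 1# _ _) ⟨
    a + ((1# + - 1#) + - b) ≈⟨ +-congˡ (+-congʳ (-‿inverseʳ 1#)) ⟩
    a + (0# + - b)          ≈⟨ +-congˡ (+-identityˡ _) ⟩
    a + - b                 ∎

  ⊖-homo : ∀ m n → ⟦ m ℤ.⊖ n ⟧ℤ ≈ m ×′ 1# + - (n ×′ 1#)
  ⊖-homo zero zero = sym (-‿inverseʳ 0#)
  ⊖-homo zero (suc n) = sym (+-identityˡ _)
  ⊖-homo (suc m) zero = sym (trans (+-congˡ -0#≈0#) (+-identityʳ _))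
  ⊖-homo (suc m) (suc n) = begin
    ⟦ suc m ℤ.⊖ suc n ⟧ℤ                ≡⟨ ≡.cong ⟦_⟧ℤ (ℤ.[1+m]⊖[1+n]≡m⊖n m n) ⟩
    ⟦ m ℤ.⊖ n ⟧ℤ                        ≈⟨ ⊖-homo m n ⟩
    m ×′ 1# + - (n ×′ 1#)               ≈⟨ +-cancel-suc _ _ ⟨
    (1# + m ×′ 1#) + - (1# + n ×′ 1#)   ≈⟨ +-cong (1+×′ m 1#) (-‿cong (1+×′ n 1#)) ⟨
    suc m ×′ 1# + - (suc n ×′ 1#)       ∎

  +-homo : ∀ x y → ⟦ x ℤ.+ y ⟧ℤ ≈ ⟦ x ⟧ℤ + ⟦ y ⟧ℤ
  +-homo (+ m) (+ n) = ×′-homo-+ 1# m n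
  +-homo (+ m) -[1+ n ] = ⊖-homo m (suc n)
  +-homo -[1+ m ] (+ n) = trans (⊖-homo n (suc m)) (+-comm _ _)
  +-homo -[1+ m ] -[1+ n ] = begin
    - (suc (suc (m ℕ.+ n)) ×′ 1#)       ≡⟨ ≡.cong (λ k → - (suc k ×′ 1#)) (ℕ.+-suc m n) ⟨
    - ((suc m ℕ.+ suc n) ×′ 1#)         ≈⟨ -‿cong (×′-homo-+ 1# (suc m) (suc n)) ⟩
    - (suc m ×′ 1# + suc n ×′ 1#)       ≈⟨ -‿+-comm _ _ ⟨
    - (suc m ×′ 1#) + - (suc n ×′ 1#)   ∎

  -‿homo : ∀ x → ⟦ ℤ.- x ⟧ℤ ≈ - ⟦ x ⟧ℤ
  -‿homo (+ zero) = sym -0#≈0#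
  -‿homo (+ suc n) = refl
  -‿homo -[1+ n ] = sym (-‿involutive _)

  *-homo⁺ : ∀ m y → ⟦ + m ℤ.* y ⟧ℤ ≈ m ×′ 1# * ⟦ y ⟧ℤ
  *-homo⁺ m (+ n) = begin
    ⟦ + m ℤ.* + n ⟧ℤ    ≡⟨ ≡.cong ⟦_⟧ℤ (ℤ.pos-* m n) ⟨
    (m ℕ.* n) ×′ 1#     ≈⟨ ×1-homo-* m n ⟩
    m ×′ 1# * n ×′ 1#   ∎
  *-homo⁺ m -[1+ n ] = begin
    ⟦ + m ℤ.* -[1+ n ] ⟧ℤ          ≡⟨ ≡.cong ⟦_⟧ℤ (ℤ.neg-distribʳ-* (+ m) (+ suc n)) ⟨
    ⟦ ℤ.- (+ m ℤ.* + suc n) ⟧ℤ     ≈⟨ -‿homo (+ m ℤ.* + suc n) ⟩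
    - ⟦ + m ℤ.* + suc n ⟧ℤ         ≈⟨ -‿cong (*-homo⁺ m (+ suc n)) ⟩
    - (m ×′ 1# * suc n ×′ 1#)      ≈⟨ -‿distribʳ-* _ _ ⟩
    m ×′ 1# * - (suc n ×′ 1#)      ∎

  *-homo : ∀ x y → ⟦ x ℤ.* y ⟧ℤ ≈ ⟦ x ⟧ℤ * ⟦ y ⟧ℤ
  *-homo (+ m) y = *-homo⁺ m y
  *-homo -[1+ m ] y = begin
    ⟦ -[1+ m ] ℤ.* y ⟧ℤ         ≡⟨ ≡.cong ⟦_⟧ℤ (ℤ.neg-distribˡ-* (+ suc m) y) ⟨
    ⟦ ℤ.- (+ suc m ℤ.* y) ⟧ℤ    ≈⟨ -‿homo (+ suc m ℤ.* y) ⟩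
    - ⟦ + suc m ℤ.* y ⟧ℤ        ≈⟨ -‿cong (*-homo⁺ (suc m) y) ⟩
    - (suc m ×′ 1# * ⟦ y ⟧ℤ)    ≈⟨ -‿distribˡ-* _ _ ⟩
    - (suc m ×′ 1#) * ⟦ y ⟧ℤ    ∎

  homomorphism : ℤ.+-*-rawRing -Raw-AlmostCommutative⟶ fromCommutativeRing R
  homomorphism = record
    { ⟦_⟧ = ⟦_⟧ℤ ; +-homo = +-homo ; *-homo = *-homo ; -‿homo = -‿homo
    ; 0-homo = refl ; 1-homo = refl }

  _≟ℤ_ : ∀ x y → Maybe (⟦ x ⟧ℤ ≈ ⟦ y ⟧ℤ)
  x ≟ℤ y with x ℤ.≟ y
  ... | yes ≡.refl = just refl
  ... | no _       = nothing

  open RingSolver ℤ.+-*-rawRing (fromCommutativeRing R) homomorphism _≟ℤ_ public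
    using (Polynomial; con; solve; _:+_; _:*_; _:-_; :-_; _:=_)

  :fromℕ : ∀ {k} → ℕ → Polynomial k
  :fromℕ zero    = con (+ 0)
  :fromℕ (suc n) = con (+ 1) :+ :fromℕ n

-- Order, inverses and the Archimedean property in a complete ordered field.

module OrderedField (ℝ : CompleteOrderedField) where
  open CompleteOrderedField ℝ hiding (zero)
  open OverReals ℝ using (fromℕ)
  open SemiringSum semiring using (sum; sum-cong-≋; sum-replicate-zero)
  open IntegerCoefficients commutativeRing public
  open IsStrictTotalOrder isStrictTotalOrder public
    using (compare)
    renaming (trans to <-trans; irrefl to <-irrefl; <-respˡ-≈ to <-respˡ; <-respʳ-≈ to <-respʳ)
  open IsTotalOrder (StrictToNonStrict.isTotalOrder _≈_ _<_ isStrictTotalOrder) public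
    using () renaming (trans to ≤-trans; reflexive to ≤-reflexive; antisym to ≤-antisym)

  open SetoidReasoning setoid

  1ᵖ : ∀ {k} → Polynomial k
  1ᵖ = con (+ 1)

  0ᵖ : ∀ {k} → Polynomial k
  0ᵖ = con (+ 0)

  ≤-refl : ∀ {x} → x ≤ x
  ≤-refl = inj₂ refl

  <⇒≤ : ∀ {x y} → x < y → x ≤ y
  <⇒≤ = inj₁

  <-≤-trans : ∀ {x y z} → x < y → y ≤ z → x < z
  <-≤-trans = StrictToNonStrict.<-≤-trans _≈_ _<_ <-trans <-respʳ

  ≤-<-trans : ∀ {x y z} → x ≤ y → y < z → x < z
  ≤-<-trans = StrictToNonStrict.≤-<-trans _≈_ _<_ sym <-trans <-respˡ

  ≤-respˡ : ∀ {x y z} → x ≈ y → x ≤ z → y ≤ z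
  ≤-respˡ x≈y = ≤-trans (≤-reflexive (sym x≈y))

  ≤-respʳ : ∀ {x y z} → x ≈ y → z ≤ x → z ≤ y
  ≤-respʳ x≈y z≤x = ≤-trans z≤x (≤-reflexive x≈y)

  ≤⇒≯ : ∀ {x y} → x ≤ y → ¬ y < x
  ≤⇒≯ x≤y y<x = <-irrefl refl (≤-<-trans x≤y y<x)

  ≤-or-> : ∀ x y → x ≤ y ⊎ y < x
  ≤-or-> x y with compare x y
  ... | tri< x<y _ _ = inj₁ (inj₁ x<y)
  ... | tri≈ _ x≈y _ = inj₁ (inj₂ x≈y)
  ... | tri> _ _ y<x = inj₂ y<x

  ≤∧≉⇒< : ∀ {x y} → x ≤ y → ¬ x ≈ y → x < y
  ≤∧≉⇒< (inj₁ x<y) _   = x<y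
  ≤∧≉⇒< (inj₂ x≈y) x≉y = contradiction x≈y x≉y

  ≮⇒≥ : ∀ {x y} → ¬ x < y → y ≤ x
  ≮⇒≥ {x} {y} x≮y with ≤-or-> y x
  ... | inj₁ y≤x = y≤x
  ... | inj₂ x<y = contradiction x<y x≮y

  <⇒0<- : ∀ {x y} → x < y → 0# < y - x
  <⇒0<- {x} x<y = <-respˡ (-‿inverseʳ x) (+-monoˡ-< (- x) x<y)

  ≤⇒0≤- : ∀ {x y} → x ≤ y → 0# ≤ y - x
  ≤⇒0≤- (inj₁ x<y)     = inj₁ (<⇒0<- x<y)
  ≤⇒0≤- {x} (inj₂ x≈y) = inj₂ (trans (sym (-‿inverseʳ x)) (+-congʳ x≈y))

  -- The form in which most inequalities are proved: the ring solver checks an identity for the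
  -- difference, and its right-hand side is visibly positive.
  <-by : ∀ {x y d} → y - x ≈ d → 0# < d → x < y
  <-by {x} {y} {d} y-x≈d 0<d =
    <-respˡ (+-identityˡ x) (<-respʳ d+x≈y (+-monoˡ-< x 0<d))
    where
    d+x≈y : d + x ≈ y
    d+x≈y = trans (+-congʳ (sym y-x≈d))
      (solve 2 (λ x y → y :- x :+ x := y) refl x y)

  ≤-by : ∀ {x y d} → y - x ≈ d → 0# ≤ d → x ≤ y
  ≤-by y-x≈d (inj₁ 0<d)         = inj₁ (<-by y-x≈d 0<d)
  ≤-by {x} {y} y-x≈d (inj₂ 0≈d) = inj₂ (begin
    x         ≈⟨ +-identityˡ x ⟨
    0# + x    ≈⟨ +-congʳ (trans 0≈d (sym y-x≈d)) ⟩
    y - x + x ≈⟨ solve 2 (λ x y → y :- x :+ x := y) refl x y ⟩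
    y         ∎)

  0<x+y : ∀ {x y} → 0# < x → 0# ≤ y → 0# < x + y
  0<x+y {x} {y} 0<x 0≤y = ≤-<-trans 0≤y (<-by (solve 2 (λ x y → x :+ y :- y := x) refl x y) 0<x)

  0≤x+y : ∀ {x y} → 0# ≤ x → 0# ≤ y → 0# ≤ x + y
  0≤x+y {x} {y} 0≤x 0≤y = ≤-trans 0≤y (≤-by (solve 2 (λ x y → x :+ y :- y := x) refl x y) 0≤x)

  0≤x*y : ∀ {x y} → 0# ≤ x → 0# ≤ y → 0# ≤ x * y
  0≤x*y (inj₁ 0<x) (inj₁ 0<y) = inj₁ (*-pos 0<x 0<y)
  0≤x*y {y = y} (inj₂ 0≈x) _  = inj₂ (trans (sym (zeroˡ y)) (*-congʳ 0≈x))
  0≤x*y {x} _ (inj₂ 0≈y)      = inj₂ (trans (sym (zeroʳ x)) (*-congˡ 0≈y))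

  0≤x² : ∀ x → 0# ≤ x * x
  0≤x² x with ≤-or-> 0# x
  ... | inj₁ 0≤x = 0≤x*y 0≤x 0≤x
  ... | inj₂ x<0 = ≤-respʳ (solve 1 (λ x → (0ᵖ :- x) :* (0ᵖ :- x) := x :* x) refl x)
                     (0≤x*y (<⇒≤ (<⇒0<- x<0)) (<⇒≤ (<⇒0<- x<0)))

  0<1 : 0# < 1#
  0<1 with 0≤x² 1#
  ... | inj₁ 0<1*1 = <-respʳ (*-identityˡ 1#) 0<1*1
  ... | inj₂ 0≈1*1 = contradiction (trans 0≈1*1 (*-identityˡ 1#)) 0≉1

  0≤1 : 0# ≤ 1#
  0≤1 = <⇒≤ 0<1

  0≤fromℕ : ∀ n → 0# ≤ fromℕ n
  0≤fromℕ zero    = ≤-refl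
  0≤fromℕ (suc n) = 0≤x+y 0≤1 (0≤fromℕ n)

  0<fromℕ : ∀ n → 0# < fromℕ (suc n)
  0<fromℕ n = 0<x+y 0<1 (0≤fromℕ n)

  0≤x+x⇒0≤x : ∀ {x} → 0# ≤ x + x → 0# ≤ x
  0≤x+x⇒0≤x {x} 0≤x+x = ≮⇒≥ λ x<0 → ≤⇒≯ 0≤x+x
    (<-by (solve 1 (λ x → 0ᵖ :- (x :+ x) := (0ᵖ :- x) :+ (0ᵖ :- x)) refl x)
      (0<x+y (<⇒0<- x<0) (<⇒≤ (<⇒0<- x<0))))

  <⇒≉ : ∀ {x y} → x < y → ¬ y ≈ x
  <⇒≉ x<y y≈x = <-irrefl (sym y≈x) x<y

  0<⇒x*x⁻¹≈1 : ∀ {x} → 0# < x → x * x ⁻¹ ≈ 1#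
  0<⇒x*x⁻¹≈1 {x} 0<x = ⁻¹-inverseʳ x (<⇒≉ 0<x)

  0<x⁻¹ : ∀ {x} → 0# < x → 0# < x ⁻¹
  0<x⁻¹ {x} 0<x with ≤-or-> (x ⁻¹) 0#
  ... | inj₂ 0<x⁻¹ = 0<x⁻¹
  ... | inj₁ x⁻¹≤0 = contradiction 0<1 (≤⇒≯ (≤-by
    (begin
      0# - 1#           ≈⟨ +-congˡ (-‿cong (0<⇒x*x⁻¹≈1 0<x)) ⟨
      0# - x * x ⁻¹     ≈⟨ solve 2 (λ x y → 0ᵖ :- x :* y := x :* (0ᵖ :- y)) refl x (x ⁻¹) ⟩
      x * (0# - x ⁻¹)   ∎)
    (0≤x*y (<⇒≤ 0<x) (≤⇒0≤- x⁻¹≤0))))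

  *-cancelˡ : ∀ {c x y} → 0# < c → c * x ≈ c * y → x ≈ y
  *-cancelˡ {c} {x} {y} 0<c cx≈cy = begin
    x                 ≈⟨ cancel x ⟨
    c ⁻¹ * (c * x)    ≈⟨ *-congˡ cx≈cy ⟩
    c ⁻¹ * (c * y)    ≈⟨ cancel y ⟩
    y                 ∎
    where
    cancel : ∀ z → c ⁻¹ * (c * z) ≈ z
    cancel z = begin
      c ⁻¹ * (c * z)  ≈⟨ solve 3 (λ i c z → i :* (c :* z) := c :* i :* z) refl (c ⁻¹) c z ⟩
      c * c ⁻¹ * z    ≈⟨ *-congʳ (0<⇒x*x⁻¹≈1 0<c) ⟩
      1# * z          ≈⟨ *-identityˡ z ⟩
      z               ∎

  -- The infimum m of the reciprocals 1/(n+1) is 0: if 0 < m, some 1/(n+1) lies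
  -- below 2m, and then 1/(2n+2) lies below m.
  archimedean : ∀ ε → 0# < ε → ∃[ n ] 1# < ε * fromℕ (suc n)
  archimedean ε 0<ε = below (proj₂ (proj₂ inf) ε (≤-<-trans m≤0 0<ε))
    where
    P : Carrier → Set
    P x = ∃[ n ] fromℕ (suc n) * x ≈ 1#

    0<P : ∀ {x} → P x → 0# < x
    0<P {x} (n , nx≈1) with ≤-or-> x 0#
    ... | inj₂ 0<x = 0<x
    ... | inj₁ x≤0 = contradiction 0<1 (≤⇒≯ (≤-by
      (begin
        0# - 1#                     ≈⟨ +-congˡ (-‿cong nx≈1) ⟨
        0# - fromℕ (suc n) * x      ≈⟨ solve 2 (λ n x → 0ᵖ :- n :* x := n :* (0ᵖ :- x)) refl (fromℕ (suc n)) x ⟩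
        fromℕ (suc n) * (0# - x)    ∎)
      (0≤x*y (0≤fromℕ (suc n)) (≤⇒0≤- x≤0))))

    inf : ∃[ m ] IsInfimum P m
    inf = infimum P (fromℕ 1 ⁻¹ , 0 , 0<⇒x*x⁻¹≈1 (0<fromℕ 0)) (0# , λ x Px → <⇒≤ (0<P Px))

    m : Carrier
    m = proj₁ inf

    halve : ∃[ x ] (P x × x < m + m) → ¬ 0# < m
    halve (x , (n , nx≈1) , x<2m) 0<m = ≤⇒≯ (2m≤x (proj₁ (proj₂ inf) h (n ℕ.+ suc n , h≈))) x<2m
      where
      k : Carrier
      k = fromℕ (suc n)
      k≈ : fromℕ (suc n ℕ.+ suc n) ≈ k + k
      k≈ = SemiringMult.×-homo-+ semiring 1# (suc n) (suc n)
      0<k+k : 0# < k + k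
      0<k+k = <-respʳ k≈ (0<fromℕ (n ℕ.+ suc n))
      h : Carrier
      h = (k + k) ⁻¹
      h≈ : fromℕ (suc n ℕ.+ suc n) * h ≈ 1#
      h≈ = trans (*-congʳ k≈) (0<⇒x*x⁻¹≈1 0<k+k)
      x≈h+h : x ≈ h + h
      x≈h+h = *-cancelˡ (0<fromℕ n) (begin
        k * x         ≈⟨ nx≈1 ⟩
        1#            ≈⟨ 0<⇒x*x⁻¹≈1 0<k+k ⟨
        (k + k) * h   ≈⟨ solve 2 (λ k h → (k :+ k) :* h := k :* (h :+ h)) refl k h ⟩
        k * (h + h)   ∎)
      2m≤x : m ≤ h → m + m ≤ x
      2m≤x m≤h = ≤-by
        (trans (+-congʳ x≈h+h) (solve 2 (λ h m → h :+ h :- (m :+ m) := (h :- m) :+ (h :- m)) refl h m))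
        (0≤x+y (≤⇒0≤- m≤h) (≤⇒0≤- m≤h))

    m≤0 : m ≤ 0#
    m≤0 = ≮⇒≥ λ 0<m → halve
      (proj₂ (proj₂ inf) (m + m) (<-by (solve 1 (λ m → m :+ m :- m := m) refl m) 0<m)) 0<m

    below : ∃[ x ] (P x × x < ε) → ∃[ n ] 1# < ε * fromℕ (suc n)
    below (x , (n , nx≈1) , x<ε) = n , <-by
      (begin
        ε * fromℕ (suc n) - 1#                ≈⟨ +-congˡ (-‿cong nx≈1) ⟨
        ε * fromℕ (suc n) - fromℕ (suc n) * x ≈⟨ solve 3 (λ e n x → e :* n :- n :* x := n :* (e :- x)) refl ε (fromℕ (suc n)) x ⟩
        fromℕ (suc n) * (ε - x)               ∎)
      (*-pos (0<fromℕ n) (<⇒0<- x<ε))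

  sum-zero : ∀ {n} {f : Vector Carrier n} → (∀ i → f i ≈ 0#) → sum f ≈ 0#
  sum-zero {n} f≈0 = trans (sum-cong-≋ f≈0) (sum-replicate-zero n)

-- Real-rootedness of Jacobi polynomials.

module RealRootedness (ℝ : CompleteOrderedField) where
  open CompleteOrderedField ℝ hiding (zero)
  open OrderedField ℝ
  open CommutativeMonoidSum *-commutativeMonoid using () renaming (sum to product)
  open SetoidReasoning setoid
  open Vec using (_∷_)

  -- One-sided Lipschitz continuity suffices: f may jump down but not up.
  intermediateValue : ∀ (f : Carrier → Carrier) {u v M} → u ≤ v → 0# < M →
    f u < 0# → 0# ≤ f v →
    (∀ {x y} → u ≤ x → x ≤ y → y ≤ v → f y - f x ≤ M * (y - x)) →
    ∃[ z ] (u ≤ z × z ≤ v × f z ≈ 0#)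
  intermediateValue f {u} {v} {M} u≤v 0<M fu<0 0≤fv lip = s , u≤s , s≤v , fs≈0
    where
    P : Carrier → Set
    P t = u ≤ t × t ≤ v × 0# ≤ f t

    inf : ∃[ m ] IsInfimum P m
    inf = infimum P (v , u≤v , ≤-refl , 0≤fv) (u , λ _ Pt → proj₁ Pt)

    s : Carrier
    s = proj₁ inf

    s≤P : ∀ t → P t → s ≤ t
    s≤P = proj₁ (proj₂ inf)

    s≤v : s ≤ v
    s≤v = s≤P v (u≤v , ≤-refl , 0≤fv)

    u≤s : u ≤ s
    u≤s = ≮⇒≥ λ s<u → beyond (proj₂ (proj₂ inf) u s<u)
      where
      beyond : ¬ (∃[ x ] (P x × x < u))
      beyond (x , (u≤x , _) , x<u) = ≤⇒≯ u≤x x<u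

    -- If `f s` were negative, the slope bound would keep `f` negative up to a distance `- f s / M`
    -- beyond `s`, so no point of `P` could come that close to its infimum.
    fs≮0 : ¬ f s < 0#
    fs≮0 fs<0 = beyond (proj₂ (proj₂ inf) (s + (0# - f s) * M ⁻¹)
        (<-by (solve 2 (λ s d → s :+ d :- s := d) refl s ((0# - f s) * M ⁻¹))
          (*-pos (<⇒0<- fs<0) (0<x⁻¹ 0<M))))
      where
      beyond : ¬ (∃[ x ] (P x × x < s + (0# - f s) * M ⁻¹))
      beyond (x , Px@(u≤x , x≤v , 0≤fx) , x<) = ≤⇒≯ 0≤fx (<-by
        (begin
          0# - f x ≈⟨ solve 5 (λ fs fx M s x →
                         0ᵖ :- fx
                      := (0ᵖ :- fs) :* 1ᵖ :+ (:- (M :* (x :- s)) :+ (M :* (x :- s) :- (fx :- fs))))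
                      refl (f s) (f x) M s x ⟩
          (0# - f s) * 1# + (- (M * (x - s)) + (M * (x - s) - (f x - f s)))
            ≈⟨ +-congʳ (*-congˡ (0<⇒x*x⁻¹≈1 0<M)) ⟨
          (0# - f s) * (M * M ⁻¹) + (- (M * (x - s)) + (M * (x - s) - (f x - f s)))
            ≈⟨ solve 6 (λ fs M i x s l →
                 (0ᵖ :- fs) :* (M :* i) :+ (:- (M :* (x :- s)) :+ l)
                 := M :* (s :+ (0ᵖ :- fs) :* i :- x) :+ l)
                 refl (f s) M (M ⁻¹) x s (M * (x - s) - (f x - f s)) ⟩
          M * (s + (0# - f s) * M ⁻¹ - x) + (M * (x - s) - (f x - f s)) ∎)
        (0<x+y (*-pos 0<M (<⇒0<- x<)) (≤⇒0≤- (lip u≤s (s≤P x Px) x≤v))))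

    -- If `f s` were positive, `f` would still be nonnegative at `t`, a step of `f s / M` back.
    -- Either `t` lies in `P` below its infimum, or `u` is within that step and `f u` would be
    -- nonnegative.
    0≮fs : ¬ 0# < f s
    0≮fs 0<fs = [ inside , outside ]′ (≤-or-> u t)
      where
      t : Carrier
      t = s - f s * M ⁻¹
      t<s : t < s
      t<s = <-by (solve 2 (λ s d → s :- (s :- d) := d) refl s (f s * M ⁻¹)) (*-pos 0<fs (0<x⁻¹ 0<M))
      0≤ft : u ≤ t → 0# ≤ f t
      0≤ft u≤t = ≤-respʳ (begin
        M * (s - t) - (f s - f t)
          ≈⟨ solve 5 (λ M s fs i ft → M :* (s :- (s :- fs :* i)) :- (fs :- ft) := M :* i :* fs :- fs :+ ft)
               refl M s (f s) (M ⁻¹) (f t) ⟩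
        M * M ⁻¹ * f s - f s + f t
          ≈⟨ +-congʳ (+-congʳ (*-congʳ (0<⇒x*x⁻¹≈1 0<M))) ⟩
        1# * f s - f s + f t
          ≈⟨ solve 2 (λ x y → 1ᵖ :* x :- x :+ y := y) refl (f s) (f t) ⟩
        f t ∎) (≤⇒0≤- (lip u≤t (<⇒≤ t<s) s≤v))
      inside : ¬ u ≤ t
      inside u≤t = ≤⇒≯ (s≤P t (u≤t , ≤-trans (<⇒≤ t<s) s≤v , 0≤ft u≤t)) t<s
      0≤fu : t < u → 0# ≤ f u
      0≤fu t<u = ≤-by (begin
        f u - 0#
          ≈⟨ solve 5 (λ fu fs M s u → fu :- 0ᵖ := (M :* (s :- u) :- (fs :- fu)) :+ (1ᵖ :* fs :- M :* (s :- u)))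
               refl (f u) (f s) M s u ⟩
        (M * (s - u) - (f s - f u)) + (1# * f s - M * (s - u))
          ≈⟨ +-congˡ (+-congʳ (*-congʳ (0<⇒x*x⁻¹≈1 0<M))) ⟨
        (M * (s - u) - (f s - f u)) + (M * M ⁻¹ * f s - M * (s - u))
          ≈⟨ +-congˡ (solve 5 (λ M i fs s u → M :* i :* fs :- M :* (s :- u) := M :* (u :- (s :- fs :* i)))
               refl M (M ⁻¹) (f s) s u) ⟩
        (M * (s - u) - (f s - f u)) + M * (u - (s - f s * M ⁻¹)) ∎)
        (0≤x+y (≤⇒0≤- (lip ≤-refl u≤s s≤v)) (0≤x*y (<⇒≤ 0<M) (<⇒≤ (<⇒0<- t<u))))
      outside : ¬ t < u
      outside t<u = ≤⇒≯ (0≤fu t<u) fu<0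

    fs≈0 : f s ≈ 0#
    fs≈0 = ≤-antisym (≮⇒≥ 0≮fs) (≮⇒≥ fs≮0)

  -- Jacobi n p q: p and q are the characteristic polynomials of a Jacobi matrix
  -- of size n and of its trailing principal submatrix.  The value 0# for q at
  -- n = 0 makes c irrelevant in the first step.
  data Jacobi : ℕ → (Carrier → Carrier) → (Carrier → Carrier) → Set where
    empty  : ∀ {p q} → (∀ t → p t ≈ 1#) → (∀ t → q t ≈ 0#) → Jacobi 0 p q
    extend : ∀ {n p q r} a c → 0# < c → Jacobi n p q →
             (∀ t → r t ≈ (t - a) * p t - c * q t) → Jacobi (suc n) r p

  -- A Darboux step at τ, where x = p τ / q τ.  At a root τ of p it splits off
  -- the factor t - τ and leaves a Jacobi sequence of size one less.
  record Darboux (n : ℕ) (p q : Carrier → Carrier) (τ x : Carrier) : Set where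
    field
      {y}      : Carrier
      {p′ q′}  : Carrier → Carrier
      0<y      : 0# < y
      jacobi   : Jacobi n p′ q′
      split    : ∀ t → p t ≈ (t - τ) * p′ t + x * q t
      split′   : ∀ t → p′ t ≈ q t + y * q′ t

  -- `ratio` plays the role of `p / q` from the largest root of `p` onwards. Growth at rate at least
  -- 1 keeps it positive beyond the root, so that the next ratio `t - a - c / ratio t` makes sense;
  -- the Lipschitz bound feeds the intermediate value theorem that finds the next root.
  record TopRoot (n : ℕ) (p q : Carrier → Carrier) : Set where
    field
      root       : Carrier
      ratio      : Carrier → Carrier
      slope      : Carrier
      0≤slope    : 0# ≤ slope
      ratio-root : ratio root ≈ 0#
      expanding  : ∀ {x y} → root ≤ x → x ≤ y → y - x ≤ ratio y - ratio x
      lipschitz  : ∀ {x y} → root ≤ x → x ≤ y → ratio y - ratio x ≤ slope * (y - x)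
      darboux    : ∀ {τ} → root ≤ τ → Darboux n p q τ (ratio τ)

    ratio-mono : ∀ {x y} → root ≤ x → x ≤ y → 0# ≤ ratio y - ratio x
    ratio-mono r≤x x≤y = ≤-trans (≤⇒0≤- x≤y) (expanding r≤x x≤y)

    ratio-lower : ∀ {x} → root ≤ x → x - root ≤ ratio x
    ratio-lower {x} r≤x = ≤-respʳ (begin
      ratio x - ratio root  ≈⟨ +-congˡ (-‿cong ratio-root) ⟩
      ratio x - 0#          ≈⟨ solve 1 (λ x → x :- 0ᵖ := x) refl (ratio x) ⟩
      ratio x               ∎) (expanding ≤-refl r≤x)

  topRoot-one : ∀ {p r} a → (∀ t → p t ≈ 1#) → (∀ t → r t ≈ (t - a) * p t) → TopRoot 0 r p
  topRoot-one {p} {r} a p≈1 r≈ = record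
    { root       = a
    ; ratio      = λ t → t - a
    ; slope      = 1#
    ; 0≤slope    = 0≤1
    ; ratio-root = -‿inverseʳ a
    ; expanding  = λ {x} {y} _ _ → ≤-reflexive (solve 3 (λ x y a → y :- x := y :- a :- (x :- a)) refl x y a)
    ; lipschitz  = λ {x} {y} _ _ → ≤-reflexive (solve 3 (λ x y a → y :- a :- (x :- a) := 1ᵖ :* (y :- x)) refl x y a)
    ; darboux    = λ {τ} _ → record
      -- `y` multiplies the zero function here; 1 is a placeholder of the required sign.
      { 0<y    = 0<1
      ; jacobi = empty {p = λ _ → 1#} {q = λ _ → 0#} (λ _ → refl) (λ _ → refl)
      ; split  = λ t → begin
          r t                            ≈⟨ r≈ t ⟩
          (t - a) * p t                  ≈⟨ solve 4 (λ t τ a p → (t :- a) :* p := (t :- τ) :* p :+ (τ :- a) :* p) refl t τ a (p t) ⟩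
          (t - τ) * p t + (τ - a) * p t  ≈⟨ +-congʳ (*-congˡ (p≈1 t)) ⟩
          (t - τ) * 1# + (τ - a) * p t   ∎
      ; split′ = λ t → trans (sym (p≈1 t)) (solve 1 (λ p → p := p :+ 1ᵖ :* 0ᵖ) refl (p t))
      }
    }

  module _ {n : ℕ} {p q r : Carrier → Carrier} (a c : Carrier) (0<c : 0# < c)
           (r≈ : ∀ t → r t ≈ (t - a) * p t - c * q t) (T : TopRoot n p q) where
    open TopRoot T

    -- With `y⁺ = c / x` the new cofactor is `p + y⁺ p′`. Eliminating `p` and `q` through the
    -- previous `split` and `split′` turns it into a recurrence over `p′` and `q′` with positive
    -- coefficient `x y`. This corresponds to exchanging the two bidiagonal factors of the shifted
    -- Jacobi matrix.
    darboux-extend : ∀ {τ} → root ≤ τ → 0# < ratio τ →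
                     Darboux (suc n) r p τ (τ - a - c * ratio τ ⁻¹)
    darboux-extend {τ} r≤τ 0<x = record
      { 0<y    = *-pos 0<c (0<x⁻¹ 0<x)
      ; jacobi = extend (τ - x - y⁺) (x * y) (*-pos 0<x 0<y) jacobi λ t → begin
          p t + y⁺ * p′ t
            ≈⟨ +-congʳ (split t) ⟩
          (t - τ) * p′ t + x * q t + y⁺ * p′ t
            ≈⟨ solve 6 (λ t τ p' x q y⁺ →
                 (t :- τ) :* p' :+ x :* q :+ y⁺ :* p' := (t :- (τ :- x :- y⁺)) :* p' :- x :* (p' :- q))
                 refl t τ (p′ t) x (q t) y⁺ ⟩
          (t - (τ - x - y⁺)) * p′ t - x * (p′ t - q t)
            ≈⟨ +-congˡ (-‿cong (*-congˡ (+-congʳ (split′ t)))) ⟩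
          (t - (τ - x - y⁺)) * p′ t - x * (q t + y * q′ t - q t)
            ≈⟨ +-congˡ (-‿cong (solve 4 (λ x q y q' → x :* (q :+ y :* q' :- q) := x :* y :* q') refl x (q t) y (q′ t))) ⟩
          (t - (τ - x - y⁺)) * p′ t - x * y * q′ t ∎
      ; split  = λ t → begin
          r t
            ≈⟨ r≈ t ⟩
          (t - a) * p t - c * q t
            ≈⟨ +-cong (*-congˡ (split t)) (-‿cong cq≈) ⟩
          (t - a) * ((t - τ) * p′ t + x * q t) - y⁺ * x * q t
            ≈⟨ solve 7 (λ t a τ p' q x y⁺ →
                 (t :- a) :* ((t :- τ) :* p' :+ x :* q) :- y⁺ :* x :* q
                 := (t :- τ) :* ((t :- τ) :* p' :+ x :* q :+ y⁺ :* p')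
                    :+ (τ :- a :- y⁺) :* ((t :- τ) :* p' :+ x :* q)) refl t a τ (p′ t) (q t) x y⁺ ⟩
          (t - τ) * ((t - τ) * p′ t + x * q t + y⁺ * p′ t) + (τ - a - y⁺) * ((t - τ) * p′ t + x * q t)
            ≈⟨ +-cong (*-congˡ (+-congʳ (split t))) (*-congˡ (split t)) ⟨
          (t - τ) * (p t + y⁺ * p′ t) + (τ - a - y⁺) * p t ∎
      ; split′ = λ _ → refl
      }
      where
      open Darboux (darboux r≤τ)
      x y⁺ : Carrier
      x = ratio τ
      y⁺ = c * x ⁻¹
      cq≈ : ∀ {z} → c * z ≈ y⁺ * x * z
      cq≈ {z} = *-congʳ (begin
        c               ≈⟨ *-identityʳ c ⟨
        c * 1#          ≈⟨ *-congˡ (0<⇒x*x⁻¹≈1 0<x) ⟨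
        c * (x * x ⁻¹)  ≈⟨ solve 3 (λ c x i → c :* (x :* i) := c :* i :* x) refl c x (x ⁻¹) ⟩
        c * x ⁻¹ * x    ∎)

    -- The next ratio is `t - a - c / ratio t`. Multiplying by `ratio t` removes the singularity at
    -- the left end `root`, where the product form takes the value `- c`.
    root⁺ : ∃[ s ] (root ≤ s × (s - a) * ratio s - c ≈ 0#)
    root⁺ = let s , r≤s , _ , eq = zero⁺ in s , r≤s , eq
      where
      f : Carrier → Carrier
      f t = (t - a) * ratio t - c

      -- At such a point `(b - a) * ratio b` is at least `ratio b`, which is at least `b - root` and
      -- so at least `c`.
      far : ∃[ b ] (1# ≤ b - a × c ≤ b - root)
      far with ≤-or-> (a + 1#) (root + c)
      ... | inj₁ le = root + c
                    , ≤-by (solve 4 (λ r c a o → r :+ c :- a :- o := r :+ c :- (a :+ o)) refl root c a 1#) (≤⇒0≤- le)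
                    , ≤-reflexive (solve 2 (λ r c → c := r :+ c :- r) refl root c)
      ... | inj₂ gt = a + 1#
                    , ≤-reflexive (solve 2 (λ a o → o := a :+ o :- a) refl a 1#)
                    , ≤-by (solve 4 (λ r c a o → a :+ o :- r :- c := a :+ o :- (r :+ c)) refl root c a 1#) (<⇒≤ (<⇒0<- gt))

      b : Carrier
      b = proj₁ far
      1≤b-a : 1# ≤ b - a
      1≤b-a = proj₁ (proj₂ far)
      c≤b-r : c ≤ b - root
      c≤b-r = proj₂ (proj₂ far)
      r≤b : root ≤ b
      r≤b = ≤-by refl (≤-trans (<⇒≤ 0<c) c≤b-r)
      c≤Rb : c ≤ ratio b
      c≤Rb = ≤-trans c≤b-r (ratio-lower r≤b)
      0≤b-a : 0# ≤ b - a
      0≤b-a = ≤-trans 0≤1 1≤b-a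

      zero⁺ : ∃[ s ] (root ≤ s × s ≤ b × f s ≈ 0#)
      zero⁺ = intermediateValue f {M = ratio b + (b - a) * slope} r≤b
        (0<x+y (<-≤-trans 0<c c≤Rb) (0≤x*y 0≤b-a 0≤slope))
        (<-by (begin
          0# - ((root - a) * ratio root - c) ≈⟨ +-congˡ (-‿cong (+-congʳ (*-congˡ ratio-root))) ⟩
          0# - ((root - a) * 0# - c)         ≈⟨ solve 2 (λ x c → 0ᵖ :- (x :* 0ᵖ :- c) := c) refl (root - a) c ⟩
          c                                  ∎) 0<c)
        (≤-by (solve 3 (λ k R c → k :* R :- c :- 0ᵖ := (k :- 1ᵖ) :* R :+ (R :- c)) refl (b - a) (ratio b) c)
          (0≤x+y (0≤x*y (≤⇒0≤- 1≤b-a) (≤-trans (<⇒≤ 0<c) c≤Rb)) (≤⇒0≤- c≤Rb)))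
        -- The increment of `(t - a) * ratio t` is `(y - x) * ratio y + (x - a) * (ratio y - ratio
        -- x)`. Bounding the second term from above takes only `x ≤ b`, whatever the sign of
        -- `x - a`.
        (λ {x} {y} r≤x x≤y y≤b → ≤-by
          (solve 9 (λ x y a c Rx Ry Rb b L →
              (Rb :+ (b :- a) :* L) :* (y :- x) :- ((y :- a) :* Ry :- c :- ((x :- a) :* Rx :- c))
           := (Rb :- Ry) :* (y :- x) :+ ((b :- a) :* (L :* (y :- x) :- (Ry :- Rx))
              :+ (((b :- y) :+ (y :- x)) :* (Ry :- Rx))))
            refl x y a c (ratio x) (ratio y) (ratio b) b slope)
          (0≤x+y (0≤x*y (ratio-mono (≤-trans r≤x x≤y) y≤b) (≤⇒0≤- x≤y))
            (0≤x+y (0≤x*y 0≤b-a (≤⇒0≤- (lipschitz r≤x x≤y)))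
              (0≤x*y (0≤x+y (≤⇒0≤- y≤b) (≤⇒0≤- x≤y)) (ratio-mono r≤x x≤y)))))

    -- From the new root `s` onwards the old ratio is at least `δ = ratio s > 0`. The new ratio has
    -- formal derivative `1 + c ratio′ / ratio²`, which accounts both for the expansion by at least
    -- 1 and for the new slope, where `ratio` is replaced by its minimum `δ`.
    topRoot-extend : TopRoot (suc n) r p
    topRoot-extend = record
      { root       = s
      ; ratio      = λ t → t - a - c * ratio t ⁻¹
      ; slope      = 1# + c * (δ ⁻¹ * δ ⁻¹) * slope
      ; 0≤slope    = 0≤x+y 0≤1 (0≤x*y 0≤cδδ 0≤slope)
      ; ratio-root = begin
          s - a - c * δ ⁻¹                ≈⟨ +-congˡ (-‿cong (*-congʳ c≈)) ⟩
          s - a - (s - a) * δ * δ ⁻¹      ≈⟨ +-congˡ (-‿cong (*-assoc _ _ _)) ⟩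
          s - a - (s - a) * (δ * δ ⁻¹)    ≈⟨ +-congˡ (-‿cong (*-congˡ (0<⇒x*x⁻¹≈1 0<δ))) ⟩
          s - a - (s - a) * 1#            ≈⟨ solve 1 (λ x → x :- x :* 1ᵖ := 0ᵖ) refl (s - a) ⟩
          0#                              ∎
      ; expanding  = λ {x} {y} s≤x x≤y → ≤-by
          (trans (solve 6 (λ x y a c i j → y :- a :- c :* j :- (x :- a :- c :* i) :- (y :- x) := c :* (i :- j))
                   refl x y a c (ratio x ⁻¹) (ratio y ⁻¹))
                 (*-congˡ (⁻¹-diff (0<ratio s≤x) (0<ratio (≤-trans s≤x x≤y)))))
          (0≤x*y (<⇒≤ 0<c) (0≤x*y (ratio-mono (≤-trans r≤s s≤x) x≤y)
            (0≤x*y (<⇒≤ (0<x⁻¹ (0<ratio s≤x))) (<⇒≤ (0<x⁻¹ (0<ratio (≤-trans s≤x x≤y)))))))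
      ; lipschitz  = λ {x} {y} s≤x x≤y → let
            i = ratio x ⁻¹; j = ratio y ⁻¹; k = δ ⁻¹; D = ratio y - ratio x
            s≤y = ≤-trans s≤x x≤y
            0≤D = ratio-mono (≤-trans r≤s s≤x) x≤y
          in ≤-by
          (begin
            (1# + c * (k * k) * slope) * (y - x) - (y - a - c * j - (x - a - c * i))
              ≈⟨ solve 8 (λ x y a c i j k L →
                  (1ᵖ :+ c :* (k :* k) :* L) :* (y :- x) :- (y :- a :- c :* j :- (x :- a :- c :* i))
                  := c :* (k :* k) :* (L :* (y :- x)) :- c :* (i :- j)) refl x y a c i j k slope ⟩
            c * (k * k) * (slope * (y - x)) - c * (i - j)
              ≈⟨ +-congˡ (-‿cong (*-congˡ (⁻¹-diff (0<ratio s≤x) (0<ratio s≤y)))) ⟩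
            c * (k * k) * (slope * (y - x)) - c * (D * (i * j))
              ≈⟨ solve 6 (λ c k l D i j → c :* (k :* k) :* l :- c :* (D :* (i :* j))
                  := c :* (k :* k) :* (l :- D) :+ c :* (D :* ((k :- i) :* k :+ i :* (k :- j))))
                  refl c k (slope * (y - x)) D i j ⟩
            c * (k * k) * (slope * (y - x) - D) + c * (D * ((k - i) * k + i * (k - j))) ∎)
          (0≤x+y (0≤x*y 0≤cδδ (≤⇒0≤- (lipschitz (≤-trans r≤s s≤x) x≤y)))
            (0≤x*y (<⇒≤ 0<c) (0≤x*y 0≤D (0≤x+y
              (0≤x*y (⁻¹-anti s≤x) (<⇒≤ (0<x⁻¹ 0<δ)))
              (0≤x*y (<⇒≤ (0<x⁻¹ (0<ratio s≤x))) (⁻¹-anti s≤y))))))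
      ; darboux    = λ s≤τ → darboux-extend (≤-trans r≤s s≤τ) (0<ratio s≤τ)
      }
      where
      s : Carrier
      s = proj₁ root⁺
      r≤s : root ≤ s
      r≤s = proj₁ (proj₂ root⁺)
      δ : Carrier
      δ = ratio s

      c≈ : c ≈ (s - a) * δ
      c≈ = begin
        c                                     ≈⟨ solve 2 (λ c x → c := x :- (x :- c)) refl c ((s - a) * δ) ⟩
        (s - a) * δ - ((s - a) * δ - c)       ≈⟨ +-congˡ (-‿cong (proj₂ (proj₂ root⁺))) ⟩
        (s - a) * δ - 0#                      ≈⟨ solve 1 (λ x → x :- 0ᵖ := x) refl ((s - a) * δ) ⟩
        (s - a) * δ                           ∎

      -- `δ = 0` would force `c = (s - a) * δ = 0`.
      0<δ : 0# < δ
      0<δ = ≤∧≉⇒< (≤-trans (≤⇒0≤- r≤s) (ratio-lower r≤s))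
        λ 0≈δ → <⇒≉ 0<c (trans c≈ (trans (*-congˡ (sym 0≈δ)) (zeroʳ _)))

      0≤cδδ : 0# ≤ c * (δ ⁻¹ * δ ⁻¹)
      0≤cδδ = 0≤x*y (<⇒≤ 0<c) (0≤x² (δ ⁻¹))

      0<ratio : ∀ {t} → s ≤ t → 0# < ratio t
      0<ratio s≤t = <-≤-trans 0<δ (≤-by refl (ratio-mono r≤s s≤t))

      ⁻¹-diff : ∀ {x y} → 0# < x → 0# < y → x ⁻¹ - y ⁻¹ ≈ (y - x) * (x ⁻¹ * y ⁻¹)
      ⁻¹-diff {x} {y} 0<x 0<y = sym (begin
        (y - x) * (x ⁻¹ * y ⁻¹)
          ≈⟨ solve 4 (λ x y i j → (y :- x) :* (i :* j) := i :* (y :* j) :- x :* i :* j) refl x y (x ⁻¹) (y ⁻¹) ⟩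
        x ⁻¹ * (y * y ⁻¹) - x * x ⁻¹ * y ⁻¹
          ≈⟨ +-cong (*-congˡ (0<⇒x*x⁻¹≈1 0<y)) (-‿cong (*-congʳ (0<⇒x*x⁻¹≈1 0<x))) ⟩
        x ⁻¹ * 1# - 1# * y ⁻¹
          ≈⟨ solve 2 (λ i j → i :* 1ᵖ :- 1ᵖ :* j := i :- j) refl (x ⁻¹) (y ⁻¹) ⟩
        x ⁻¹ - y ⁻¹ ∎)

      ⁻¹-anti : ∀ {t} → s ≤ t → 0# ≤ δ ⁻¹ - ratio t ⁻¹
      ⁻¹-anti s≤t = ≤-respʳ (sym (⁻¹-diff 0<δ (0<ratio s≤t)))
        (0≤x*y (ratio-mono r≤s s≤t) (0≤x*y (<⇒≤ (0<x⁻¹ 0<δ)) (<⇒≤ (0<x⁻¹ (0<ratio s≤t)))))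

  topRoot : ∀ {n p q} → Jacobi (suc n) p q → TopRoot n p q
  topRoot (extend {p = p} {q} {r} a c 0<c (empty p≈1 q≈0) r≈) = topRoot-one a p≈1 λ t → begin
    r t                       ≈⟨ r≈ t ⟩
    (t - a) * p t - c * q t   ≈⟨ +-congˡ (-‿cong (*-congˡ (q≈0 t))) ⟩
    (t - a) * p t - c * 0#    ≈⟨ solve 2 (λ x c → x :- c :* 0ᵖ := x) refl ((t - a) * p t) c ⟩
    (t - a) * p t             ∎
  topRoot (extend a c 0<c J@(extend _ _ _ _ _) r≈) = topRoot-extend a c 0<c r≈ (topRoot J)

  -- At the top root the ratio vanishes, so `split` becomes a factorisation, and its cofactor is
  -- again a Jacobi polynomial, of degree one less.
  jacobi-splits : ∀ {n p q} → Jacobi n p q →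
                  Σ[ μ ∈ Vector Carrier n ] (∀ t → p t ≈ product (λ i → t - μ i))
  jacobi-splits {zero} (empty p≈1 _) = (λ ()) , p≈1
  jacobi-splits {suc n} {p} {q} J = root ∷ proj₁ rest , λ t → begin
    p t                              ≈⟨ split t ⟩
    (t - root) * p′ t + ratio root * q t
                                     ≈⟨ +-cong (*-congˡ (proj₂ rest t)) (trans (*-congʳ ratio-root) (zeroˡ _)) ⟩
    (t - root) * product (λ i → t - proj₁ rest i) + 0#
                                     ≈⟨ +-identityʳ _ ⟩
    (t - root) * product (λ i → t - proj₁ rest i) ∎
    where
    open TopRoot (topRoot J)
    open Darboux (darboux ≤-refl)
    rest : Σ[ μ ∈ Vector Carrier n ] (∀ t → p′ t ≈ product (λ i → t - μ i))
    rest = jacobi-splits jacobi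

-- Characteristic polynomials of tridiagonal matrices and the first two power sums of a spectrum.

module Moments (ℝ : CompleteOrderedField) where
  open CompleteOrderedField ℝ hiding (zero)
  open OverReals ℝ
  open OrderedField ℝ
  open RingProperties ring using (-0#≈0#)
  open SemiringSum semiring using (sum; sum-syntax; sum-cong-≋)
  open CommutativeMonoidSum *-commutativeMonoid using () renaming (sum to product)
  open SemiringExp semiring using (_^_)
  open SetoidReasoning setoid

  det-cong : ∀ {n} {A B : Matrix n} → (∀ i j → A i j ≈ B i j) → det A ≈ det B
  det-cong {zero}  A≈B = refl
  det-cong {suc n} A≈B = sum-cong-≋ λ j → *-congˡ {(- 1#) ^ toℕ j}
    (*-cong (A≈B zero j) (det-cong λ i k → A≈B (suc i) (punchIn j k)))

  minor : ∀ {n} → Matrix (suc n) → Matrix n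
  minor A i j = A (suc i) (suc j)

  det-zeroColumn : ∀ {n} {A : Matrix (suc n)} → (∀ i → A i zero ≈ 0#) → det A ≈ 0#
  det-zeroColumn {zero} {A} A₀≈0 = begin
    1# * (A zero zero * 1#) + 0#  ≈⟨ solve 1 (λ a → 1ᵖ :* (a :* 1ᵖ) :+ 0ᵖ := a) refl (A zero zero) ⟩
    A zero zero                   ≈⟨ A₀≈0 zero ⟩
    0#                            ∎
  det-zeroColumn {suc n} {A} A₀≈0 = sum-zero vanish
    where
    vanish : ∀ j → (- 1#) ^ toℕ j * (A zero j * det (λ i k → A (suc i) (punchIn j k))) ≈ 0#
    vanish zero    = trans (*-congˡ (trans (*-congʳ (A₀≈0 zero)) (zeroˡ _))) (zeroʳ _)
    vanish (suc j) = trans (*-congˡ (trans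
      (*-congˡ (det-zeroColumn {A = λ i k → A (suc i) (punchIn (suc j) k)} λ i → A₀≈0 (suc i)))
      (zeroʳ _))) (zeroʳ ((- 1#) ^ suc (toℕ j)))

  det-block : ∀ {n} {A : Matrix (suc n)} → (∀ i → A (suc i) zero ≈ 0#) →
              det A ≈ A zero zero * det (minor A)
  det-block {zero}  {A} _ = solve 1 (λ a → 1ᵖ :* (a :* 1ᵖ) :+ 0ᵖ := a :* 1ᵖ) refl (A zero zero)
  det-block {suc n} {A} A₀≈0 = begin
    1# * (A zero zero * det (minor A)) + _  ≈⟨ +-cong (*-identityˡ _) (sum-zero λ j → trans (*-congˡ (trans
      (*-congˡ (det-zeroColumn {A = λ i k → A (suc i) (punchIn (suc j) k)} A₀≈0))
      (zeroʳ (A zero (suc j))))) (zeroʳ ((- 1#) ^ suc (toℕ j)))) ⟩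
    A zero zero * det (minor A) + 0#        ≈⟨ +-identityʳ _ ⟩
    A zero zero * det (minor A)             ∎

  -- Two cofactors of the first row survive. In the second, deleting a column leaves a first column
  -- supported in its top entry, so `det-block` leads on to the double minor.
  det-tridiagonal : ∀ {n} {A : Matrix (suc (suc n))} →
    (∀ j → A zero (suc (suc j)) ≈ 0#) → (∀ i → A (suc (suc i)) zero ≈ 0#) →
    det A ≈ A zero zero * det (minor A) - A zero (suc zero) * A (suc zero) zero * det (minor (minor A))
  det-tridiagonal {n} {A} row column = begin
    1# * (a * d) + ((- 1#) * 1# * (b * m) + sum s)
      ≈⟨ +-congˡ (+-cong (*-congˡ (*-congˡ (det-block {A = λ i k → A (suc i) (punchIn (suc zero) k)} column)))
           (sum-zero {f = s} λ j → trans (*-congˡ (trans (*-congʳ (row j)) (zeroˡ _)))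
             (zeroʳ ((- 1#) ^ suc (suc (toℕ j)))))) ⟩
    1# * (a * d) + ((- 1#) * 1# * (b * (c * d′)) + 0#)
      ≈⟨ solve 5 (λ a b c d d' → 1ᵖ :* (a :* d) :+ ((:- 1ᵖ) :* 1ᵖ :* (b :* (c :* d')) :+ 0ᵖ)
                    := a :* d :- b :* c :* d') refl a b c d d′ ⟩
    a * d - b * c * d′ ∎
    where
    a b c d d′ m : Carrier
    a = A zero zero
    b = A zero (suc zero)
    c = A (suc zero) zero
    d = det (minor A)
    d′ = det (minor (minor A))
    m = det (λ i k → A (suc i) (punchIn (suc zero) k))
    s : Vector Carrier n
    s j = (- 1#) ^ suc (suc (toℕ j)) *
          (A zero (suc (suc j)) * det (λ i k → A (suc i) (punchIn (suc (suc j)) k)))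

  Tridiagonal : ∀ {n} → Matrix n → Set
  Tridiagonal {n} A = ∀ i j → i ≢ j → ¬ Adj (path n) i j → A i j ≈ 0#

  minor-tridiagonal : ∀ {n} {A : Matrix (suc n)} → Tridiagonal A → Tridiagonal (minor A)
  minor-tridiagonal tri i j i≢j ¬adj = tri (suc i) (suc j) (λ eq → i≢j (Fin.suc-injective eq))
    λ { (inj₁ eq) → ¬adj (inj₁ (ℕ.suc-injective eq)) ; (inj₂ eq) → ¬adj (inj₂ (ℕ.suc-injective eq)) }

  tridiagonal-row : ∀ {n} {A : Matrix (suc (suc n))} → Tridiagonal A → ∀ j → A zero (suc (suc j)) ≈ 0#
  tridiagonal-row tri j = tri zero (suc (suc j)) (λ ()) λ { (inj₁ ()) ; (inj₂ ()) }

  tridiagonal-column : ∀ {n} {A : Matrix (suc (suc n))} → Tridiagonal A → ∀ i → A (suc (suc i)) zero ≈ 0#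
  tridiagonal-column tri i = tri (suc (suc i)) zero (λ ()) λ { (inj₁ ()) ; (inj₂ ()) }

  charPoly : ∀ {n} → Matrix n → Carrier → Carrier
  charPoly A t = det (λ i j → t * identity i j - A i j)

  charPoly-one : ∀ (A : Matrix 1) t → charPoly A t ≈ (t - A zero zero) * 1#
  charPoly-one A t = solve 2 (λ t a → 1ᵖ :* ((t :* 1ᵖ :- a) :* 1ᵖ) :+ 0ᵖ := (t :- a) :* 1ᵖ) refl t (A zero zero)

  charPoly-tridiagonal : ∀ {n} {A : Matrix (suc (suc n))} → Tridiagonal A → ∀ t →
    charPoly A t ≈ (t - A zero zero) * charPoly (minor A) t
                   - A zero (suc zero) * A (suc zero) zero * charPoly (minor (minor A)) t
  charPoly-tridiagonal {n} {A} tri t = trans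
    (det-tridiagonal {A = λ i j → t * identity i j - A i j} (λ j → offdiagonal (tridiagonal-row tri j)) (λ i → offdiagonal (tridiagonal-column tri i)))
    (solve 6 (λ t a b c d d' → (t :* 1ᵖ :- a) :* d :- (t :* 0ᵖ :- b) :* (t :* 0ᵖ :- c) :* d'
                := (t :- a) :* d :- b :* c :* d') refl
      t (A zero zero) (A zero (suc zero)) (A (suc zero) zero) (charPoly (minor A) t) (charPoly (minor (minor A)) t))
    where
    offdiagonal : ∀ {x} → x ≈ 0# → t * 0# - x ≈ 0#
    offdiagonal x≈0 = trans (+-cong (zeroʳ t) (trans (-‿cong x≈0) -0#≈0#)) (+-identityˡ 0#)

  -- The trace of A² when A is tridiagonal.
  traceSq : ∀ {n} → Matrix n → Carrier
  traceSq {zero}        A = 0#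
  traceSq {suc zero}    A = A zero zero * A zero zero
  traceSq {suc (suc n)} A =
    traceSq (minor A) + A zero zero * A zero zero + fromℕ 2 * (A zero (suc zero) * A (suc zero) zero)

  -- A bound on the absolute value over `(0, 1]`, split into two nonnegative quantities so that
  -- bounds combine by ring identities.
  record Bounded (f : Carrier → Carrier) : Set where
    field
      bound : Carrier
      lower : ∀ {s} → 0# < s → s ≤ 1# → 0# ≤ bound + f s
      upper : ∀ {s} → 0# < s → s ≤ 1# → 0# ≤ bound - f s

  open Bounded

  0≤bound : ∀ {f} (b : Bounded f) → 0# ≤ bound b
  0≤bound {f} b = 0≤x+x⇒0≤x (≤-respʳ
    (solve 2 (λ b f → b :+ f :+ (b :- f) := b :+ b) refl (bound b) (f 1#))
    (0≤x+y (lower b 0<1 ≤-refl) (upper b 0<1 ≤-refl)))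

  bounded-const : ∀ c → Bounded (λ _ → c)
  bounded-const c with ≤-or-> 0# c
  ... | inj₁ 0≤c = record
    { bound = c
    ; lower = λ _ _ → 0≤x+y 0≤c 0≤c
    ; upper = λ _ _ → inj₂ (sym (-‿inverseʳ c)) }
  ... | inj₂ c<0 = record
    { bound = - c
    ; lower = λ _ _ → inj₂ (sym (-‿inverseˡ c))
    ; upper = λ _ _ → ≤-respʳ (solve 1 (λ c → (0ᵖ :- c) :+ (0ᵖ :- c) := :- c :- c) refl c)
                        (<⇒≤ (0<x+y (<⇒0<- c<0) (<⇒≤ (<⇒0<- c<0)))) }

  bounded-id : Bounded (λ s → s)
  bounded-id = record
    { bound = 1#
    ; lower = λ 0<s _ → 0≤x+y 0≤1 (<⇒≤ 0<s)
    ; upper = λ _ s≤1 → ≤⇒0≤- s≤1 }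

  bounded-+ : ∀ {f g} → Bounded f → Bounded g → Bounded (λ s → f s + g s)
  bounded-+ {f} {g} F G = record
    { bound = bound F + bound G
    ; lower = λ {s} 0<s s≤1 → ≤-respʳ
        (solve 4 (λ a b x y → a :+ x :+ (b :+ y) := a :+ b :+ (x :+ y)) refl (bound F) (bound G) (f s) (g s))
        (0≤x+y (lower F 0<s s≤1) (lower G 0<s s≤1))
    ; upper = λ {s} 0<s s≤1 → ≤-respʳ
        (solve 4 (λ a b x y → a :- x :+ (b :- y) := a :+ b :- (x :+ y)) refl (bound F) (bound G) (f s) (g s))
        (0≤x+y (upper F 0<s s≤1) (upper G 0<s s≤1)) }

  -- For `a`, `b` bounding `x`, `y`, the nonnegative products `(a + x)(b + y)` and `(a - x)(b - y)`
  -- add up to `2 (a b + x y)`; with mixed signs the sum is `2 (a b - x y)`.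
  bounded-* : ∀ {f g} → Bounded f → Bounded g → Bounded (λ s → f s * g s)
  bounded-* {f} {g} F G = record
    { bound = bound F * bound G
    ; lower = λ {s} 0<s s≤1 → 0≤x+x⇒0≤x (≤-respʳ
        (solve 4 (λ a b x y → (a :+ x) :* (b :+ y) :+ (a :- x) :* (b :- y) := a :* b :+ x :* y :+ (a :* b :+ x :* y))
          refl (bound F) (bound G) (f s) (g s))
        (0≤x+y (0≤x*y (lower F 0<s s≤1) (lower G 0<s s≤1)) (0≤x*y (upper F 0<s s≤1) (upper G 0<s s≤1))))
    ; upper = λ {s} 0<s s≤1 → 0≤x+x⇒0≤x (≤-respʳ
        (solve 4 (λ a b x y → (a :+ x) :* (b :- y) :+ (a :- x) :* (b :+ y) := a :* b :- x :* y :+ (a :* b :- x :* y))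
          refl (bound F) (bound G) (f s) (g s))
        (0≤x+y (0≤x*y (lower F 0<s s≤1) (upper G 0<s s≤1)) (0≤x*y (upper F 0<s s≤1) (lower G 0<s s≤1)))) }

  bounded-neg : ∀ {f} → Bounded f → Bounded (λ s → - f s)
  bounded-neg {f} F = record
    { bound = bound F
    ; lower = upper F
    ; upper = λ {s} 0<s s≤1 → ≤-respʳ (solve 2 (λ b x → b :+ x := b :- (:- x)) refl (bound F) (f s)) (lower F 0<s s≤1) }

  -- A single small `s` replaces the limit: at `s = d / (bound H + d)`, which is at most 1, the term
  -- `s * h s` is at least `- s * bound H`, and `d - s * bound H = d * s` is positive.
  constantTerm≯0 : ∀ {h d} → Bounded h → (∀ s → 0# < s → s ≤ 1# → d + s * h s ≈ 0#) → ¬ 0# < d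
  constantTerm≯0 {h} {d} H eq 0<d = <-irrefl (sym (eq s 0<s s≤1)) (<-by
    (begin
      d + s * h s - 0#
        ≈⟨ solve 4 (λ d i b x → d :+ d :* i :* x :- 0ᵖ := d :* 1ᵖ :- d :* i :* b :+ d :* i :* (b :+ x)) refl d i (bound H) (h s) ⟩
      d * 1# - s * bound H + s * (bound H + h s)
        ≈⟨ +-congʳ (+-congʳ (*-congˡ (0<⇒x*x⁻¹≈1 0<b+d))) ⟨
      d * ((bound H + d) * i) - s * bound H + s * (bound H + h s)
        ≈⟨ +-congʳ (solve 3 (λ d i b → d :* ((b :+ d) :* i) :- d :* i :* b := d :* (d :* i)) refl d i (bound H)) ⟩
      d * (d * i) + s * (bound H + h s) ∎)
    (0<x+y (*-pos 0<d 0<s) (0≤x*y (<⇒≤ 0<s) (lower H 0<s s≤1))))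
    where
    0<b+d : 0# < bound H + d
    0<b+d = <-respʳ (+-comm d (bound H)) (0<x+y 0<d (0≤bound H))
    i s : Carrier
    i = (bound H + d) ⁻¹
    s = d * i
    0<s : 0# < s
    0<s = *-pos 0<d (0<x⁻¹ 0<b+d)
    s≤1 : s ≤ 1#
    s≤1 = ≤-by (begin
      1# - d * i                ≈⟨ +-congʳ (0<⇒x*x⁻¹≈1 0<b+d) ⟨
      (bound H + d) * i - d * i ≈⟨ solve 3 (λ b d i → (b :+ d) :* i :- d :* i := b :* i) refl (bound H) d i ⟩
      bound H * i               ∎) (0≤x*y (0≤bound H) (<⇒≤ (0<x⁻¹ 0<b+d)))

  constantTerm≈0 : ∀ {h d} → Bounded h → (∀ s → 0# < s → s ≤ 1# → d + s * h s ≈ 0#) → d ≈ 0#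
  constantTerm≈0 {h} {d} H eq = ≤-antisym
    (≮⇒≥ (constantTerm≯0 H eq))
    (≮⇒≥ λ d<0 → constantTerm≯0 (bounded-neg H)
      (λ s 0<s s≤1 → begin
        0# - d + s * (- h s)    ≈⟨ solve 3 (λ d s x → 0ᵖ :- d :+ s :* (:- x) := :- (d :+ s :* x)) refl d s (h s) ⟩
        - (d + s * h s)         ≈⟨ -‿cong (eq s 0<s s≤1) ⟩
        - 0#                    ≈⟨ -0#≈0# ⟩
        0#                      ∎)
      (<⇒0<- d<0))

  -- f is tⁿ - e tⁿ⁻¹ + ½(e² - p) tⁿ⁻² + O(tⁿ⁻³), read off at t = 1/s as s → 0:
  -- when f is a product of n factors t - μᵢ, e = ∑ μᵢ and p = ∑ μᵢ².
  record Jet (n : ℕ) (f : Carrier → Carrier) (e p : Carrier) : Set where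
    field
      remainder : Carrier → Carrier
      bounded   : Bounded remainder
      expansion : ∀ {s t} → 0# < s → s ≤ 1# → s * t ≈ 1# →
        fromℕ 2 * (s ^ n * f t) ≈
        fromℕ 2 - fromℕ 2 * e * s + (e * e - p) * (s * s) + s * s * s * remainder s

  open Jet

  jet-empty : ∀ {f} → (∀ t → f t ≈ 1#) → Jet 0 f 0# 0#
  jet-empty f≈1 = record
    { remainder = λ _ → 0#
    ; bounded   = bounded-const 0#
    ; expansion = λ {s} {t} _ _ _ → trans (*-congˡ (*-congˡ (f≈1 t)))
        (solve 1 (λ s → :fromℕ 2 :* (1ᵖ :* 1ᵖ) := :fromℕ 2 :- :fromℕ 2 :* 0ᵖ :* s :+ (0ᵖ :* 0ᵖ :- 0ᵖ) :* (s :* s) :+ s :* s :* s :* 0ᵖ) refl s) }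

  jet-cong : ∀ {n f e e′ p p′} → e ≈ e′ → p ≈ p′ → Jet n f e p → Jet n f e′ p′
  jet-cong e≈ p≈ J = record
    { remainder = remainder J
    ; bounded   = bounded J
    ; expansion = λ 0<s s≤1 st≈1 → trans (expansion J 0<s s≤1 st≈1)
        (+-congʳ (+-cong (+-congˡ (-‿cong (*-congʳ (*-congˡ e≈)))) (*-congʳ (+-cong (*-cong e≈ e≈) (-‿cong p≈))))) }

  -- With `s t = 1` the extra factor `s (t - a)` is `1 - a s`. Multiplying the expansion by it adds
  -- `a` to the sum and `a²` to the sum of squares.
  jet-linear : ∀ {n f r e p} a → Jet n f e p → (∀ t → r t ≈ (t - a) * f t) →
               Jet (suc n) r (a + e) (a * a + p)
  jet-linear {n} {f} {r} {e} {p} a J r≈ = record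
    { remainder = λ s → remainder J s + (- (a * (e * e - p)) + (- a) * s * remainder J s)
    ; bounded   = bounded-+ (bounded J) (bounded-+ (bounded-const _)
                    (bounded-* (bounded-* (bounded-const _) bounded-id) (bounded J)))
    ; expansion = λ {s} {t} 0<s s≤1 st≈1 → begin
        fromℕ 2 * (s * s ^ n * r t)
          ≈⟨ *-congˡ (*-congˡ (r≈ t)) ⟩
        fromℕ 2 * (s * s ^ n * ((t - a) * f t))
          ≈⟨ solve 6 (λ k s w t a f → k :* (s :* w :* ((t :- a) :* f)) := (s :* t :- a :* s) :* (k :* (w :* f)))
               refl (fromℕ 2) s (s ^ n) t a (f t) ⟩
        (s * t - a * s) * (fromℕ 2 * (s ^ n * f t))
          ≈⟨ *-cong (+-congʳ st≈1) (expansion J 0<s s≤1 st≈1) ⟩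
        (1# - a * s) * (fromℕ 2 - fromℕ 2 * e * s + (e * e - p) * (s * s) + s * s * s * remainder J s)
          ≈⟨ solve 5 (λ a s e p g →
               (1ᵖ :- a :* s) :* (:fromℕ 2 :- :fromℕ 2 :* e :* s :+ (e :* e :- p) :* (s :* s) :+ s :* s :* s :* g)
               := :fromℕ 2 :- :fromℕ 2 :* (a :+ e) :* s :+ ((a :+ e) :* (a :+ e) :- (a :* a :+ p)) :* (s :* s)
                  :+ s :* s :* s :* (g :+ (:- (a :* (e :* e :- p)) :+ (:- a) :* s :* g)))
               refl a s e p (remainder J s) ⟩
        fromℕ 2 - fromℕ 2 * (a + e) * s + ((a + e) * (a + e) - (a * a + p)) * (s * s)
          + s * s * s * (remainder J s + (- (a * (e * e - p)) + (- a) * s * remainder J s)) ∎ }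

  -- Since `h` has degree lower by two, `c h` first shows at `s²`, where in the doubled expansion it
  -- lowers `e² - p` by `2 c`.
  jet-perturb : ∀ {n f h r e p e′ p′} c → Jet (suc (suc n)) f e p → Jet n h e′ p′ →
                (∀ t → r t ≈ f t - c * h t) → Jet (suc (suc n)) r e (p + fromℕ 2 * c)
  jet-perturb {n} {f} {h} {r} {e} {p} {e′} {p′} c F H r≈ = record
    { remainder = λ s → remainder F s + (c * fromℕ 2 * e′ + (- c) * (s * ((e′ * e′ - p′) + s * remainder H s)))
    ; bounded   = bounded-+ (bounded F) (bounded-+ (bounded-const _) (bounded-* (bounded-const _)
                    (bounded-* bounded-id (bounded-+ (bounded-const _) (bounded-* bounded-id (bounded H))))))
    ; expansion = λ {s} {t} 0<s s≤1 st≈1 → begin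
        fromℕ 2 * (s ^ suc (suc n) * r t)
          ≈⟨ *-congˡ (*-congˡ (r≈ t)) ⟩
        fromℕ 2 * (s * (s * s ^ n) * (f t - c * h t))
          ≈⟨ solve 6 (λ k s w f c h → k :* (s :* (s :* w) :* (f :- c :* h))
               := k :* (s :* (s :* w) :* f) :- c :* (s :* s) :* (k :* (w :* h)))
               refl (fromℕ 2) s (s ^ n) (f t) c (h t) ⟩
        fromℕ 2 * (s ^ suc (suc n) * f t) - c * (s * s) * (fromℕ 2 * (s ^ n * h t))
          ≈⟨ +-cong (expansion F 0<s s≤1 st≈1) (-‿cong (*-congˡ (expansion H 0<s s≤1 st≈1))) ⟩
        fromℕ 2 - fromℕ 2 * e * s + (e * e - p) * (s * s) + s * s * s * remainder F s
          - c * (s * s) * (fromℕ 2 - fromℕ 2 * e′ * s + (e′ * e′ - p′) * (s * s) + s * s * s * remainder H s)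
          ≈⟨ solve 8 (λ c s e p g e' p' g' →
               :fromℕ 2 :- :fromℕ 2 :* e :* s :+ (e :* e :- p) :* (s :* s) :+ s :* s :* s :* g
               :- c :* (s :* s) :* (:fromℕ 2 :- :fromℕ 2 :* e' :* s :+ (e' :* e' :- p') :* (s :* s) :+ s :* s :* s :* g')
               := :fromℕ 2 :- :fromℕ 2 :* e :* s :+ (e :* e :- (p :+ :fromℕ 2 :* c)) :* (s :* s)
                  :+ s :* s :* s :* (g :+ (c :* :fromℕ 2 :* e' :+ (:- c) :* (s :* ((e' :* e' :- p') :+ s :* g')))))
               refl c s e p (remainder F s) e′ p′ (remainder H s) ⟩
        fromℕ 2 - fromℕ 2 * e * s + (e * e - (p + fromℕ 2 * c)) * (s * s)
          + s * s * s * (remainder F s + (c * fromℕ 2 * e′ + (- c) * (s * ((e′ * e′ - p′) + s * remainder H s)))) ∎ }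

  jet-product : ∀ {n} (μ : Vector Carrier n) →
                Jet n (λ t → product (λ i → t - μ i)) (sum μ) (∑[ i < n ] (μ i * μ i))
  jet-product {zero}  μ = jet-empty (λ _ → refl)
  jet-product {suc n} μ = jet-linear (μ zero) (jet-product (λ i → μ (suc i))) (λ _ → refl)

  -- In the three-term recurrence the factor `t - a` contributes the diagonal entry to both sums,
  -- and the subtracted double minor contributes twice the product of the off-diagonal pair to the
  -- second. `traceSq` follows the same recursion.
  jet-charPoly : ∀ {n} {A : Matrix n} → Tridiagonal A → Jet n (charPoly A) (trace A) (traceSq A)
  jet-charPoly {zero} _ = jet-empty (λ _ → refl)
  jet-charPoly {suc zero} {A} _ =
    jet-cong refl (+-identityʳ _) (jet-linear (A zero zero) (jet-empty (λ _ → refl)) (charPoly-one A))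
  jet-charPoly {suc (suc n)} {A} tri = jet-cong refl (+-congʳ (+-comm _ _))
    (jet-perturb (A zero (suc zero) * A (suc zero) zero)
      (jet-linear (A zero zero) (jet-charPoly tri′) (λ _ → refl))
      (jet-charPoly (minor-tridiagonal tri′))
      (charPoly-tridiagonal tri))
    where
    tri′ : Tridiagonal (minor A)
    tri′ = minor-tridiagonal tri

  -- Subtracting the expansions at `t = s ⁻¹` and dividing by `s` leaves a function with constant
  -- term `2 e′ - 2 e`, which must vanish; dividing by `s` again compares the second power sums.
  jet-unique : ∀ {n f g e p e′ p′} → Jet n f e p → Jet n g e′ p′ → (∀ t → f t ≈ g t) → e ≈ e′ × p ≈ p′
  jet-unique {n} {f} {g} {e} {p} {e′} {p′} F G f≈g = e≈e′ , p≈p′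
    where
    2e′-2e D : Carrier
    2e′-2e = fromℕ 2 * e′ - fromℕ 2 * e
    D = (e * e - p) - (e′ * e′ - p′)
    R : Carrier → Carrier
    R s = remainder F s - remainder G s
    bounded-R : Bounded R
    bounded-R = bounded-+ (bounded F) (bounded-neg (bounded G))

    difference : ∀ s → 0# < s → s ≤ 1# → 2e′-2e + s * (D + s * R s) ≈ 0#
    difference s 0<s s≤1 = *-cancelˡ 0<s (begin
      s * (2e′-2e + s * (D + s * R s))
        ≈⟨ solve 7 (λ s e p g e' p' g' →
             s :* ((:fromℕ 2 :* e' :- :fromℕ 2 :* e) :+ s :* (((e :* e :- p) :- (e' :* e' :- p')) :+ s :* (g :- g')))
             := :fromℕ 2 :- :fromℕ 2 :* e :* s :+ (e :* e :- p) :* (s :* s) :+ s :* s :* s :* g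
                :- (:fromℕ 2 :- :fromℕ 2 :* e' :* s :+ (e' :* e' :- p') :* (s :* s) :+ s :* s :* s :* g'))
             refl s e p (remainder F s) e′ p′ (remainder G s) ⟩
      _ ≈⟨ +-cong (expansion F 0<s s≤1 st≈1) (-‿cong (expansion G 0<s s≤1 st≈1)) ⟨
      fromℕ 2 * (s ^ n * f (s ⁻¹)) - fromℕ 2 * (s ^ n * g (s ⁻¹))
        ≈⟨ +-congʳ (*-congˡ (*-congˡ (f≈g (s ⁻¹)))) ⟩
      fromℕ 2 * (s ^ n * g (s ⁻¹)) - fromℕ 2 * (s ^ n * g (s ⁻¹))
        ≈⟨ -‿inverseʳ _ ⟩
      0# ≈⟨ zeroʳ s ⟨
      s * 0# ∎)
      where
      st≈1 : s * s ⁻¹ ≈ 1#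
      st≈1 = 0<⇒x*x⁻¹≈1 0<s

    2e′-2e≈0 : 2e′-2e ≈ 0#
    2e′-2e≈0 = constantTerm≈0 (bounded-+ (bounded-const D) (bounded-* bounded-id bounded-R)) difference

    e≈e′ : e ≈ e′
    e≈e′ = *-cancelˡ (0<fromℕ 1) (begin
      fromℕ 2 * e                ≈⟨ solve 2 (λ x y → x := y :- (y :- x)) refl (fromℕ 2 * e) (fromℕ 2 * e′) ⟩
      fromℕ 2 * e′ - 2e′-2e      ≈⟨ +-congˡ (-‿cong 2e′-2e≈0) ⟩
      fromℕ 2 * e′ - 0#          ≈⟨ solve 1 (λ y → y :- 0ᵖ := y) refl (fromℕ 2 * e′) ⟩
      fromℕ 2 * e′               ∎)

    D≈0 : D ≈ 0#
    D≈0 = constantTerm≈0 bounded-R λ s 0<s s≤1 → *-cancelˡ 0<s (begin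
      s * (D + s * R s)                ≈⟨ +-identityˡ _ ⟨
      0# + s * (D + s * R s)           ≈⟨ +-congʳ 2e′-2e≈0 ⟨
      2e′-2e + s * (D + s * R s)       ≈⟨ difference s 0<s s≤1 ⟩
      0#                               ≈⟨ zeroʳ s ⟨
      s * 0#                           ∎)

    p≈p′ : p ≈ p′
    p≈p′ = begin
      p                                ≈⟨ solve 4 (λ p p' x x' → p := p' :+ (x :- x') :- (x :- p :- (x' :- p'))) refl p p′ (e * e) (e′ * e′) ⟩
      p′ + (e * e - e′ * e′) - D       ≈⟨ +-cong (+-congˡ (+-congʳ (*-cong e≈e′ e≈e′))) (-‿cong D≈0) ⟩
      p′ + (e′ * e′ - e′ * e′) - 0#    ≈⟨ solve 2 (λ p' x → p' :+ (x :- x) :- 0ᵖ := p') refl p′ (e′ * e′) ⟩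
      p′                               ∎

  module _ {n} {A : Matrix n} (tri : Tridiagonal A) (μ : Vector Carrier n) (spec : IsSpectrum A μ) where
    sum-spectrum : trace A ≈ sum μ
    sum-spectrum = proj₁ (jet-unique (jet-charPoly tri) (jet-product μ) spec)

    sumSq-spectrum : traceSq A ≈ ∑[ i < n ] (μ i * μ i)
    sumSq-spectrum = proj₂ (jet-unique (jet-charPoly tri) (jet-product μ) spec)

-- The edge list of a path and its line graph.

module PathEdges where
  open import Data.List.Base
    using (List; []; _∷_; [_]; _++_; map; filter; length; lookup; tabulate; allFin; cartesianProduct)
  open import Data.List.Properties
    using (++-identityʳ; filter-++; filter-accept; filter-reject; filter-none; map-tabulate; length-tabulate; lookup-tabulate)
  open import Data.List.Relation.Unary.All.Properties using (tabulate⁺)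

  filter-unique : ∀ {A : Set} {P : A → Set} (P? : ∀ a → Dec (P a)) {n} (f : Fin n → A) i →
                  P (f i) → (∀ j → P (f j) → j ≡ i) → filter P? (tabulate f) ≡ [ f i ]
  filter-unique P? f zero Pfi uniq = ≡.trans (filter-accept P? Pfi) (≡.cong (f zero ∷_)
    (filter-none P? (tabulate⁺ λ j Pfj → contradiction (uniq (suc j) Pfj) λ ())))
  filter-unique P? f (suc i) Pfi uniq = ≡.trans
    (filter-reject P? λ Pf0 → contradiction (uniq zero Pf0) λ ())
    (filter-unique P? (λ j → f (suc j)) i Pfi λ j Pfj → Fin.suc-injective (uniq (suc j) Pfj))

  -- The list of pairs is a concatenation of rows. For a path each row keeps one pair, except the
  -- last: the last vertex has no larger neighbour.
  filter-rows : ∀ {A B : Set} {P : A × B → Set} (P? : ∀ a → Dec (P a)) (ys : List B)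
    {k} (f : Fin (suc k) → A) (g : Fin k → A × B) →
    (∀ i → filter P? (map (f (inject₁ i) ,_) ys) ≡ [ g i ]) →
    filter P? (map (f (Fin.fromℕ k) ,_) ys) ≡ [] →
    filter P? (cartesianProduct (tabulate f) ys) ≡ tabulate g
  filter-rows P? ys {zero} f g _ last =
    ≡.trans (≡.cong (filter P?) (++-identityʳ (map (f zero ,_) ys))) last
  filter-rows P? ys {suc k} f g rows last = ≡.trans
    (filter-++ P? (map (f zero ,_) ys) _)
    (≡.cong₂ _++_ (rows zero) (filter-rows P? ys (λ i → f (suc i)) (λ i → g (suc i)) (λ i → rows (suc i)) last))

  edges-path : ∀ m → edges (path (suc m)) ≡ tabulate (λ i → inject₁ i , suc i)
  edges-path m = filter-rows P? (allFin (suc m)) (λ i → i) _ row last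
    where
    P : Fin (suc m) × Fin (suc m) → Set
    P (i , j) = (i Fin.< j) × Adj (path (suc m)) i j
    P? : ∀ e → Dec (P e)
    P? (i , j) = (i Fin.<? j) ×-dec adj? (path (suc m)) i j

    row : ∀ i → filter P? (map (inject₁ i ,_) (allFin (suc m))) ≡ [ inject₁ i , suc i ]
    row i = ≡.trans (≡.cong (filter P?) (map-tabulate (λ j → j) (inject₁ i ,_)))
      (filter-unique P? (inject₁ i ,_) (suc i) (ℕ.≤-reflexive eq , inj₁ eq) uniq)
      where
      eq : suc (toℕ (inject₁ i)) ≡ toℕ (suc i)
      eq = ≡.cong suc (Fin.toℕ-inject₁ i)
      uniq : ∀ j → P (inject₁ i , j) → j ≡ suc i
      uniq j (_ , inj₁ adj)   = Fin.toℕ-injective (≡.trans (≡.sym adj) eq)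
      uniq j (i<j , inj₂ adj) = contradiction (ℕ.<-trans (ℕ.≤-reflexive adj) i<j) (ℕ.<-irrefl ≡.refl)

    last : filter P? (map (Fin.fromℕ m ,_) (allFin (suc m))) ≡ []
    last = ≡.trans (≡.cong (filter P?) (map-tabulate (λ j → j) (Fin.fromℕ m ,_)))
      (filter-none P? (tabulate⁺ λ j (m<j , _) → ℕ.<⇒≱ (≡.subst (ℕ._< toℕ j) (Fin.toℕ-fromℕ m) m<j) (Fin.toℕ≤pred[n] j)))

  size-path : ∀ m → size (path (suc m)) ≡ m
  size-path m = ≡.trans (≡.cong length (edges-path m)) (length-tabulate _)

  lookup-edges-path : ∀ m (a : Fin (size (path (suc m)))) →
    toℕ (proj₁ (lookup (edges (path (suc m))) a)) ≡ toℕ a ×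
    toℕ (proj₂ (lookup (edges (path (suc m))) a)) ≡ suc (toℕ a)
  lookup-edges-path m = ≡.subst Indexed (≡.sym (edges-path m)) indexed
    where
    -- The positions in a list form a type that depends on the list, so the claim is stated for an
    -- arbitrary list before the computed one is substituted.
    Indexed : List (Fin (suc m) × Fin (suc m)) → Set
    Indexed es = ∀ a → toℕ (proj₁ (lookup es a)) ≡ toℕ a × toℕ (proj₂ (lookup es a)) ≡ suc (toℕ a)

    f : Fin m → Fin (suc m) × Fin (suc m)
    f i = inject₁ i , suc i

    indexed : Indexed (tabulate f)
    indexed a rewrite ≡.trans (≡.cong (lookup (tabulate f)) (≡.sym (Fin.cast-involutive (≡.sym (length-tabulate f)) (length-tabulate f) a)))
                              (lookup-tabulate f (Fin.cast (length-tabulate f) a)) =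
      ≡.trans (Fin.toℕ-inject₁ _) (Fin.toℕ-cast _ a) , ≡.cong suc (Fin.toℕ-cast _ a)

  -- Edge number `a` joins the vertices `a` and `a + 1`. A common left end or a common right end
  -- forces `a = b`; the two mixed cases say that the numbers are consecutive.
  lineGraph-path : ∀ m (a b : Fin (size (path (suc m)))) →
    Adj (lineGraph (path (suc m))) a b ⇔ Adj (path (size (path (suc m)))) a b
  lineGraph-path m a b = mk⇔ to from
    where
    end : Fin (size (path (suc m))) → Fin (suc m) × Fin (suc m)
    end = lookup (edges (path (suc m)))

    end₁ : ∀ c → toℕ (proj₁ (end c)) ≡ toℕ c
    end₁ c = proj₁ (lookup-edges-path m c)
    end₂ : ∀ c → toℕ (proj₂ (end c)) ≡ suc (toℕ c)
    end₂ c = proj₂ (lookup-edges-path m c)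

    to : Adj (lineGraph (path (suc m))) a b → Adj (path (size (path (suc m)))) a b
    to (a≢b , v , inj₁ p , inj₁ q) = contradiction
      (Fin.toℕ-injective (≡.trans (≡.sym (end₁ a)) (≡.trans (≡.cong toℕ (≡.trans (≡.sym p) q)) (end₁ b)))) a≢b
    to (a≢b , v , inj₁ p , inj₂ q) =
      inj₂ (≡.trans (≡.sym (end₂ b)) (≡.trans (≡.cong toℕ (≡.trans (≡.sym q) p)) (end₁ a)))
    to (a≢b , v , inj₂ p , inj₁ q) =
      inj₁ (≡.trans (≡.sym (end₂ a)) (≡.trans (≡.cong toℕ (≡.trans (≡.sym p) q)) (end₁ b)))
    to (a≢b , v , inj₂ p , inj₂ q) = contradiction
      (Fin.toℕ-injective (ℕ.suc-injective
        (≡.trans (≡.sym (end₂ a)) (≡.trans (≡.cong toℕ (≡.trans (≡.sym p) q)) (end₂ b))))) a≢b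

    from : Adj (path (size (path (suc m)))) a b → Adj (lineGraph (path (suc m))) a b
    from adj@(inj₁ eq) = (λ a≡b → irrefl (path _) a≡b adj) , proj₂ (end a) , inj₂ ≡.refl ,
      inj₁ (Fin.toℕ-injective (≡.trans (end₂ a) (≡.trans eq (≡.sym (end₁ b)))))
    from adj@(inj₂ eq) = (λ a≡b → irrefl (path _) a≡b adj) , proj₁ (end a) , inj₁ ≡.refl ,
      inj₂ (Fin.toℕ-injective (≡.trans (end₁ a) (≡.trans (≡.sym eq) (≡.sym (end₂ b)))))

-- Eligibility: inverting 4I plus the adjacency matrix of a path.

module PathEligible (ℝ : CompleteOrderedField) where
  open CompleteOrderedField ℝ hiding (zero)
  open OverReals ℝ
  open OrderedField ℝ
  open PathEdges
  open SemiringSum semiring using (sum-syntax; sum-cong-≋; ∑-comm; *-distribˡ-sum; *-distribʳ-sum)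
  open Vec using (_∷_)
  open SetoidReasoning setoid

  identity-sym : ∀ {n} (i j : Fin n) → identity i j ≈ identity j i
  identity-sym zero    zero    = refl
  identity-sym zero    (suc j) = refl
  identity-sym (suc i) zero    = refl
  identity-sym (suc i) (suc j) = identity-sym i j

  sum-identityˡ : ∀ {n} (f : Vector Carrier n) i → ∑[ k < n ] (identity i k * f k) ≈ f i
  sum-identityˡ f zero    = trans (+-cong (*-identityˡ _) (sum-zero λ k → zeroˡ (f (suc k)))) (+-identityʳ _)
  sum-identityˡ f (suc i) = trans (+-cong (zeroˡ _) (sum-identityˡ (λ k → f (suc k)) i)) (+-identityˡ _)

  sum-identityʳ : ∀ {n} (f : Vector Carrier n) j → ∑[ k < n ] (f k * identity k j) ≈ f j
  sum-identityʳ f j = trans (sum-cong-≋ λ k → trans (*-comm _ _) (*-congʳ (identity-sym k j))) (sum-identityˡ f j)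

  sum-assoc : ∀ {m n} (a : Vector Carrier m) (T : Fin m → Fin n → Carrier) (x : Vector Carrier n) →
    ∑[ k < m ] (a k * ∑[ l < n ] (T k l * x l)) ≈ ∑[ l < n ] (∑[ k < m ] (a k * T k l) * x l)
  sum-assoc {m} {n} a T x = begin
    ∑[ k < m ] (a k * ∑[ l < n ] (T k l * x l))     ≈⟨ sum-cong-≋ (λ k → *-distribˡ-sum (a k) (λ l → T k l * x l)) ⟩
    ∑[ k < m ] ∑[ l < n ] (a k * (T k l * x l))     ≈⟨ ∑-comm (λ k l → a k * (T k l * x l)) ⟩
    ∑[ l < n ] ∑[ k < m ] (a k * (T k l * x l))     ≈⟨ sum-cong-≋ (λ l → sum-cong-≋ λ k → sym (*-assoc (a k) (T k l) (x l))) ⟩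
    ∑[ l < n ] ∑[ k < m ] (a k * T k l * x l)       ≈⟨ sum-cong-≋ (λ l → *-distribʳ-sum (x l) (λ k → a k * T k l)) ⟨
    ∑[ l < n ] (∑[ k < m ] (a k * T k l) * x l)     ∎

  -- Transposing `T N = I` makes `Nᵗ` a left inverse of the symmetric `T`, and then
  -- `Nᵗ = Nᵗ (T N) = N`.
  symmetric-leftInverse : ∀ {n} {T N : Matrix n} → (∀ i j → T i j ≈ T j i) →
    (∀ i j → (T ⊡ N) i j ≈ identity i j) → ∀ i j → (N ⊡ T) i j ≈ identity i j
  symmetric-leftInverse {n} {T} {N} T-sym TN≈1 i j =
    trans (sum-cong-≋ λ k → *-congʳ (sym (Nᵗ≈N i k))) (NᵗT≈1 i j)
    where
    Nᵗ : Matrix n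
    Nᵗ i j = N j i
    NᵗT≈1 : ∀ i j → (Nᵗ ⊡ T) i j ≈ identity i j
    NᵗT≈1 i j = begin
      ∑[ k < n ] (N k i * T k j)   ≈⟨ sum-cong-≋ (λ k → trans (*-comm _ _) (*-congʳ (T-sym k j))) ⟩
      ∑[ k < n ] (T j k * N k i)   ≈⟨ TN≈1 j i ⟩
      identity j i                 ≈⟨ identity-sym j i ⟩
      identity i j                 ∎
    Nᵗ≈N : ∀ i j → Nᵗ i j ≈ N i j
    Nᵗ≈N i j = begin
      Nᵗ i j                                               ≈⟨ sum-identityʳ (Nᵗ i) j ⟨
      ∑[ k < n ] (Nᵗ i k * identity k j)                   ≈⟨ sum-cong-≋ (λ k → *-congˡ (TN≈1 k j)) ⟨
      ∑[ k < n ] (Nᵗ i k * ∑[ l < n ] (T k l * N l j))     ≈⟨ sum-assoc (Nᵗ i) T (λ l → N l j) ⟩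
      ∑[ l < n ] (∑[ k < n ] (Nᵗ i k * T k l) * N l j)     ≈⟨ sum-cong-≋ (λ l → *-congʳ (NᵗT≈1 i l)) ⟩
      ∑[ l < n ] (identity i l * N l j)                    ≈⟨ sum-identityˡ (λ l → N l j) i ⟩
      N i j                                                ∎

  4+path : ∀ {m} → Matrix m
  4+path {m} i j = fromℕ 4 * identity i j + adjacencyMatrix (path m) i j

  4+path-sym : ∀ {m} (i j : Fin m) → 4+path i j ≈ 4+path j i
  4+path-sym {m} i j = +-cong (*-congˡ (identity-sym i j))
    (reflexive (≡.cong (if_then 1# else 0#) (∨-comm (does (suc (toℕ i) ℕ.≟ toℕ j)) _)))

  atHead : ∀ {m} → Carrier → Vector Carrier m
  atHead z zero    = z
  atHead z (suc _) = 0#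

  head₀ : ∀ {m} → Vector Carrier m → Carrier
  head₀ {zero}  _ = 0#
  head₀ {suc _} x = x zero

  -- Elimination from the last vertex to the first: 1/(4 - pivot) eliminates a
  -- variable, and z carries the contribution of the preceding unknown.
  pivot : ℕ → Carrier
  pivot zero    = 0#
  pivot (suc m) = (fromℕ 4 - pivot m) ⁻¹

  offset : ∀ {m} → Vector Carrier m → Carrier
  offset {zero}  b = 0#
  offset {suc m} b = (b zero - offset (λ i → b (suc i))) * pivot (suc m)

  solution : ∀ {m} → Carrier → Vector Carrier m → Vector Carrier m
  solution {zero}  z b = λ ()
  solution {suc m} z b = x₀ ∷ solution x₀ (λ i → b (suc i))
    where
    x₀ : Carrier
    x₀ = (b zero - offset (λ i → b (suc i)) - z) * pivot (suc m)

  -- Diagonal dominance as an induction: a pivot of at most 1 leaves at least 3 in `4 - pivot`, so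
  -- the next pivot is at most 1/3.
  pivot≤1 : ∀ m → pivot m ≤ 1#
  3≤4-pivot : ∀ m → fromℕ 3 ≤ fromℕ 4 - pivot m
  3≤4-pivot m = ≤-by (solve 1 (λ p → :fromℕ 4 :- p :- :fromℕ 3 := 1ᵖ :- p) refl (pivot m))
    (≤⇒0≤- (pivot≤1 m))

  0<4-pivot : ∀ m → 0# < fromℕ 4 - pivot m
  0<4-pivot m = <-≤-trans (0<fromℕ 2) (3≤4-pivot m)

  pivot-inverse : ∀ m → (fromℕ 4 - pivot m) * pivot (suc m) ≈ 1#
  pivot-inverse m = 0<⇒x*x⁻¹≈1 (0<4-pivot m)

  0<pivot : ∀ m → 0# < pivot (suc m)
  0<pivot m = 0<x⁻¹ (0<4-pivot m)

  3pivot≤1 : ∀ m → fromℕ 3 * pivot (suc m) ≤ 1#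
  3pivot≤1 m = ≤-by (begin
    1# - fromℕ 3 * pivot (suc m)                                   ≈⟨ +-congʳ (pivot-inverse m) ⟨
    (fromℕ 4 - pivot m) * pivot (suc m) - fromℕ 3 * pivot (suc m)  ≈⟨ solve 3 (λ x y p → x :* p :- y :* p := (x :- y) :* p) refl (fromℕ 4 - pivot m) (fromℕ 3) (pivot (suc m)) ⟩
    (fromℕ 4 - pivot m - fromℕ 3) * pivot (suc m)                  ∎)
    (0≤x*y (≤⇒0≤- (3≤4-pivot m)) (<⇒≤ (0<pivot m)))

  pivot≤1 zero    = 0≤1
  pivot≤1 (suc m) = ≤-trans
    (≤-by (solve 1 (λ p → :fromℕ 3 :* p :- p := p :+ p) refl (pivot (suc m))) (0≤x+y (<⇒≤ (0<pivot m)) (<⇒≤ (0<pivot m))))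
    (3pivot≤1 m)

  -- The first unknown is affine in the preceding one, with `offset` as constant term and
  -- `- pivot m` as slope. On the empty system both are 0, which closes the last row.
  head₀-solution : ∀ {m} z (b : Vector Carrier m) → head₀ (solution z b) ≈ offset b - pivot m * z
  head₀-solution {zero}  z b = solve 1 (λ z → 0ᵖ := 0ᵖ :- 0ᵖ :* z) refl z
  head₀-solution {suc m} z b = solve 4 (λ b o z p → (b :- o :- z) :* p := (b :- o) :* p :- p :* z) refl
    (b zero) (offset (λ i → b (suc i))) z (pivot (suc m))

  firstRow : ∀ {m} (x : Vector Carrier m) →
             ∑[ j < m ] (4+path {suc m} zero (suc j) * x j) ≈ head₀ x
  firstRow {zero}  x = refl
  firstRow {suc m} x = begin
    (fromℕ 4 * 0# + 1#) * x zero + ∑[ j < m ] ((fromℕ 4 * 0# + 0#) * x (suc j))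
      ≈⟨ +-cong (solve 1 (λ x → (:fromℕ 4 :* 0ᵖ :+ 1ᵖ) :* x := x) refl (x zero))
                (sum-zero λ j → solve 1 (λ x → (:fromℕ 4 :* 0ᵖ :+ 0ᵖ) :* x := 0ᵖ) refl (x (suc j))) ⟩
    x zero + 0#
      ≈⟨ +-identityʳ _ ⟩
    x zero ∎

  firstColumn : ∀ {m} (i : Fin m) x → 4+path {suc m} (suc i) zero * x ≈ atHead x i
  firstColumn zero    x = solve 1 (λ x → (:fromℕ 4 :* 0ᵖ :+ 1ᵖ) :* x := x) refl x
  firstColumn (suc i) x = solve 1 (λ x → (:fromℕ 4 :* 0ᵖ :+ 0ᵖ) :* x := 0ᵖ) refl x

  -- `atHead z` is the coupling to the unknown before the subsystem. With it, the equations after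
  -- the first are exactly the system for the tail, started at `x₀`.
  solution-solves : ∀ {m} z (b : Vector Carrier m) i → atHead z i + (4+path ⊡ᵥ solution z b) i ≈ b i
  solution-solves {suc m} z b zero = begin
    z + ((fromℕ 4 * 1# + 0#) * x₀ + ∑[ j < m ] (4+path {suc m} zero (suc j) * solution x₀ b′ j))
      ≈⟨ +-congˡ (+-congˡ (trans (firstRow (solution x₀ b′)) (head₀-solution x₀ b′))) ⟩
    z + ((fromℕ 4 * 1# + 0#) * x₀ + (offset b′ - pivot m * x₀))
      ≈⟨ solve 5 (λ z b o p i →
           z :+ ((:fromℕ 4 :* 1ᵖ :+ 0ᵖ) :* ((b :- o :- z) :* i) :+ (o :- p :* ((b :- o :- z) :* i)))
           := z :+ (b :- o :- z) :* ((:fromℕ 4 :- p) :* i) :+ o) refl z (b zero) (offset b′) (pivot m) (pivot (suc m)) ⟩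
    z + (b zero - offset b′ - z) * ((fromℕ 4 - pivot m) * pivot (suc m)) + offset b′
      ≈⟨ +-congʳ (+-congˡ (*-congˡ (pivot-inverse m))) ⟩
    z + (b zero - offset b′ - z) * 1# + offset b′
      ≈⟨ solve 3 (λ z b o → z :+ (b :- o :- z) :* 1ᵖ :+ o := b) refl z (b zero) (offset b′) ⟩
    b zero ∎
    where
    b′ : Vector Carrier m
    b′ i = b (suc i)
    x₀ : Carrier
    x₀ = (b zero - offset b′ - z) * pivot (suc m)
  solution-solves {suc m} z b (suc i) = trans (+-identityˡ _)
    (trans (+-congʳ (firstColumn i _)) (solution-solves _ (λ i → b (suc i)) i))

  ones : ∀ {m} → Vector Carrier m
  ones _ = 1#

  -- The bound 1/3 makes 1 - offset - z positive in every step.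
  offset-ones : ∀ m → 0# ≤ offset (ones {m}) × fromℕ 3 * offset (ones {m}) ≤ 1#
  offset-ones zero    = ≤-refl , ≤-respˡ (sym (zeroʳ (fromℕ 3))) 0≤1
  offset-ones (suc m) = 0≤x*y 0≤1-o (<⇒≤ (0<pivot m)) ,
    ≤-trans (≤-by (solve 2 (λ o p → :fromℕ 3 :* p :- :fromℕ 3 :* ((1ᵖ :- o) :* p) := :fromℕ 3 :* (o :* p)) refl o (pivot (suc m)))
              (0≤x*y (0≤fromℕ 3) (0≤x*y 0≤o (<⇒≤ (0<pivot m)))))
            (3pivot≤1 m)
    where
    o : Carrier
    o = offset (ones {m})
    0≤o : 0# ≤ o
    0≤o = proj₁ (offset-ones m)
    0≤1-o : 0# ≤ 1# - o
    0≤1-o = ≤-respʳ (solve 1 (λ o → 1ᵖ :- :fromℕ 3 :* o :+ (o :+ o) := 1ᵖ :- o) refl o)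
      (0≤x+y (≤⇒0≤- (proj₂ (offset-ones m))) (0≤x+y 0≤o 0≤o))

  -- The range `0 ≤ z ≤ 1/3` is invariant: with `offset ≤ 1/3` it gives `1 - offset - z ≥ 1/3`,
  -- hence `x₀ > 0`, while `x₀ ≤ pivot ≤ 1/3` is the hypothesis for the tail.
  solution-positive : ∀ {m} z → 0# ≤ z → fromℕ 3 * z ≤ 1# → ∀ i → 0# < solution z (ones {m}) i
  solution-positive {suc m} z 0≤z 3z≤1 = λ where
      zero    → 0<x₀
      (suc i) → solution-positive {m} x₀ (<⇒≤ 0<x₀) 3x₀≤1 i
    where
    o p x₀ : Carrier
    o = offset (ones {m})
    p = pivot (suc m)
    x₀ = (1# - o - z) * p
    0<1-o-z : 0# < 1# - o - z
    0<1-o-z = [ (λ k≤0 → contradiction (<-≤-trans 0<1 1≤3k) (≤⇒≯ (≤-by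
        (solve 2 (λ t k → 0ᵖ :- t :* k := t :* (0ᵖ :- k)) refl (fromℕ 3) (1# - o - z))
        (0≤x*y (0≤fromℕ 3) (≤⇒0≤- k≤0))))) , (λ 0<k → 0<k) ]′ (≤-or-> (1# - o - z) 0#)
      where
      1≤3k : 1# ≤ fromℕ 3 * (1# - o - z)
      1≤3k = ≤-by (solve 2 (λ o z → :fromℕ 3 :* (1ᵖ :- o :- z) :- 1ᵖ := (1ᵖ :- :fromℕ 3 :* o) :+ (1ᵖ :- :fromℕ 3 :* z)) refl o z)
        (0≤x+y (≤⇒0≤- (proj₂ (offset-ones m))) (≤⇒0≤- 3z≤1))
    0<x₀ : 0# < x₀
    0<x₀ = *-pos 0<1-o-z (0<pivot m)
    3x₀≤1 : fromℕ 3 * x₀ ≤ 1#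
    3x₀≤1 = ≤-trans
      (≤-by (solve 3 (λ o z p → :fromℕ 3 :* p :- :fromℕ 3 :* ((1ᵖ :- o :- z) :* p) := :fromℕ 3 :* ((o :+ z) :* p)) refl o z p)
        (0≤x*y (0≤fromℕ 3) (0≤x*y (0≤x+y (proj₁ (offset-ones m)) 0≤z) (<⇒≤ (0<pivot m)))))
      (3pivot≤1 m)

  4+path-inverse : ∀ {m} → Matrix m
  4+path-inverse i j = solution 0# (λ k → identity k j) i

  4+path-solves : ∀ {m} (b : Vector Carrier m) i → (4+path ⊡ᵥ solution 0# b) i ≈ b i
  4+path-solves b i = trans (sym (+-identityˡ _)) (trans (+-congʳ (0≈atHead i)) (solution-solves 0# b i))
    where
    0≈atHead : ∀ {m} (i : Fin m) → 0# ≈ atHead 0# i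
    0≈atHead zero    = refl
    0≈atHead (suc _) = refl

  4+path-rightInverse : ∀ {m} (i j : Fin m) → (4+path ⊡ 4+path-inverse) i j ≈ identity i j
  4+path-rightInverse i j = 4+path-solves (λ k → identity k j) i

  4+path-leftInverse : ∀ {m} (i j : Fin m) → (4+path-inverse ⊡ 4+path) i j ≈ identity i j
  4+path-leftInverse = symmetric-leftInverse 4+path-sym 4+path-rightInverse

  -- For `x` with `T x = 1` a left inverse `N` gives `N 1 = N (T x) = x`, so positivity of the
  -- explicit solution carries over.
  4+path-inverse-ones : ∀ {m} (e : Fin m) → 0# < (4+path-inverse ⊡ᵥ ones) e
  4+path-inverse-ones {m} e = <-respʳ (begin
    x e                                                        ≈⟨ sum-identityˡ x e ⟨
    ∑[ l < m ] (identity e l * x l)                            ≈⟨ sum-cong-≋ (λ l → *-congʳ (4+path-leftInverse e l)) ⟨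
    ∑[ l < m ] ((4+path-inverse ⊡ 4+path) e l * x l)           ≈⟨ sum-assoc (4+path-inverse e) 4+path x ⟨
    ∑[ k < m ] (4+path-inverse e k * (4+path ⊡ᵥ x) k)          ≈⟨ sum-cong-≋ (λ k → *-congˡ {4+path-inverse e k} (4+path-solves ones k)) ⟩
    (4+path-inverse ⊡ᵥ ones) e                                 ∎)
    (solution-positive 0# ≤-refl (≤-respˡ (sym (zeroʳ (fromℕ 3))) 0≤1) e)
    where
    x : Vector Carrier m
    x = solution 0# ones

  eligible-path : ∀ m → Eligible (path (suc m))
  eligible-path m = 4+path-inverse
    , ((λ i j → trans (sum-cong-≋ λ k → *-congʳ (M₂≈ i k)) (4+path-rightInverse i j))
    , (λ i j → trans (sum-cong-≋ λ k → *-congˡ (M₂≈ k j)) (4+path-leftInverse i j)))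
    , 4+path-inverse-ones
    where
    M₂≈ : ∀ i j → M₂ (path (suc m)) i j ≈ 4+path i j
    M₂≈ i j = +-congˡ (reflexive (≡.cong (if_then 1# else 0#)
      (does-⇔ (lineGraph-path m i j) (adj? (lineGraph (path (suc m))) i j) (adj? (path _) i j))))

-- Variances of weighted path Laplacians and the limit of their infimum.

module PathVariance (ℝ : CompleteOrderedField) where
  open CompleteOrderedField ℝ hiding (zero)
  open OverReals ℝ
  open OrderedField ℝ
  open Moments ℝ
  open RealRootedness ℝ
  open PathEdges using (size-path)
  open SemiringSum semiring using (sum; sum-syntax; ∑-distrib-+)
  open CommutativeMonoidSum *-commutativeMonoid using () renaming (sum to product)
  open SemiringMult semiring using (×1-homo-*)
  open Vec using (_∷_)
  open SetoidReasoning setoid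

  sum-except : ∀ {n} (f : Vector Carrier n) i →
               ∑[ k < n ] (if does (k Fin.≟ i) then 0# else f k) + f i ≈ sum f
  sum-except f zero    = solve 2 (λ x y → 0ᵖ :+ x :+ y := y :+ x) refl _ (f zero)
  sum-except f (suc i) = trans (+-assoc _ _ _) (+-congˡ (sum-except (λ k → f (suc k)) i))

  superdiagonal : ∀ {n} → Matrix n → Carrier
  superdiagonal {zero}        A = 0#
  superdiagonal {suc zero}    A = 0#
  superdiagonal {suc (suc n)} A = A zero (suc zero) + superdiagonal (minor A)

  -- When all row sums vanish, this fixes the superdiagonal sum at minus half the trace.
  total-tridiagonal : ∀ {n} {A : Matrix n} → Tridiagonal A → (∀ i j → A i j ≈ A j i) →
    ∑[ i < n ] ∑[ j < n ] A i j ≈ trace A + fromℕ 2 * superdiagonal A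
  total-tridiagonal {zero} _ _ = solve 0 (0ᵖ := 0ᵖ :+ :fromℕ 2 :* 0ᵖ) refl
  total-tridiagonal {suc zero} {A} _ _ =
    solve 1 (λ a → a :+ 0ᵖ :+ 0ᵖ := a :+ 0ᵖ :+ :fromℕ 2 :* 0ᵖ) refl (A zero zero)
  total-tridiagonal {suc (suc n)} {A} tri A-sym = begin
    a + (b + sum r) + ∑[ i < suc n ] (A (suc i) zero + ∑[ j < suc n ] minor A i j)
      ≈⟨ +-cong (+-congˡ (+-congˡ (sum-zero (tridiagonal-row tri)))) (∑-distrib-+ (λ i → A (suc i) zero) (λ i → sum (minor A i))) ⟩
    a + (b + 0#) + (A (suc zero) zero + sum c + ∑[ i < suc n ] ∑[ j < suc n ] minor A i j)
      ≈⟨ +-congˡ (+-cong (+-cong (A-sym (suc zero) zero) (sum-zero (tridiagonal-column tri)))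
           (total-tridiagonal (minor-tridiagonal tri) (λ i j → A-sym (suc i) (suc j)))) ⟩
    a + (b + 0#) + (b + 0# + (trace (minor A) + fromℕ 2 * superdiagonal (minor A)))
      ≈⟨ solve 4 (λ a b t s → a :+ (b :+ 0ᵖ) :+ (b :+ 0ᵖ :+ (t :+ :fromℕ 2 :* s)) := a :+ t :+ :fromℕ 2 :* (b :+ s))
           refl a b (trace (minor A)) (superdiagonal (minor A)) ⟩
    a + trace (minor A) + fromℕ 2 * (b + superdiagonal (minor A)) ∎
    where
    a b : Carrier
    a = A zero zero
    b = A zero (suc zero)
    r c : Vector Carrier n
    r j = A zero (suc (suc j))
    c i = A (suc (suc i)) zero

  -- The sum of (aᵢ - 2)² over the diagonal and 2 (b + 1)² over the superdiagonal.
  traceSq-lower : ∀ {m} {A : Matrix (suc m)} → (∀ i j → A i j ≈ A j i) →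
    0# ≤ traceSq A - fromℕ 4 * trace A + fromℕ 4 * superdiagonal A + fromℕ 6 * fromℕ m + fromℕ 4
  traceSq-lower {zero} {A} _ = ≤-respʳ
    (solve 1 (λ a → (a :- :fromℕ 2) :* (a :- :fromℕ 2)
       := a :* a :- :fromℕ 4 :* (a :+ 0ᵖ) :+ :fromℕ 4 :* 0ᵖ :+ :fromℕ 6 :* 0ᵖ :+ :fromℕ 4) refl (A zero zero))
    (0≤x² (A zero zero - fromℕ 2))
  traceSq-lower {suc m} {A} A-sym = ≤-respʳ
    (begin
      L + ((a - fromℕ 2) * (a - fromℕ 2) + fromℕ 2 * ((b + 1#) * (b + 1#)))
        ≈⟨ solve 6 (λ S T s m a b →
             S :- :fromℕ 4 :* T :+ :fromℕ 4 :* s :+ :fromℕ 6 :* m :+ :fromℕ 4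
               :+ ((a :- :fromℕ 2) :* (a :- :fromℕ 2) :+ :fromℕ 2 :* ((b :+ 1ᵖ) :* (b :+ 1ᵖ)))
             := (S :+ a :* a :+ :fromℕ 2 :* (b :* b)) :- :fromℕ 4 :* (a :+ T) :+ :fromℕ 4 :* (b :+ s)
               :+ :fromℕ 6 :* (1ᵖ :+ m) :+ :fromℕ 4)
             refl (traceSq (minor A)) (trace (minor A)) (superdiagonal (minor A)) (fromℕ m) a b ⟩
      (traceSq (minor A) + a * a + fromℕ 2 * (b * b)) - fromℕ 4 * trace A + fromℕ 4 * superdiagonal A
        + fromℕ 6 * fromℕ (suc m) + fromℕ 4
        ≈⟨ +-congʳ (+-congʳ (+-congʳ (+-congʳ (+-congˡ (*-congˡ (*-congˡ (A-sym zero (suc zero)))))))) ⟩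
      traceSq A - fromℕ 4 * trace A + fromℕ 4 * superdiagonal A + fromℕ 6 * fromℕ (suc m) + fromℕ 4 ∎)
    (0≤x+y (traceSq-lower {A = minor A} (λ i j → A-sym (suc i) (suc j)))
      (0≤x+y (0≤x² (a - fromℕ 2)) (0≤x*y (0≤fromℕ 2) (0≤x² (b + 1#)))))
    where
    a b L : Carrier
    a = A zero zero
    b = A zero (suc zero)
    L = traceSq (minor A) - fromℕ 4 * trace (minor A) + fromℕ 4 * superdiagonal (minor A) + fromℕ 6 * fromℕ m + fromℕ 4

  fromℕ-double-size : ∀ m → fromℕ (2 ℕ.* size (path (suc m))) ≈ fromℕ 2 * fromℕ m
  fromℕ-double-size m = trans (reflexive (≡.cong (λ k → fromℕ (2 ℕ.* k)) (size-path m))) (×1-homo-* 2 m)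

  -- The linear terms of the sum of squares, `- 4 T + 4 D`, equal `- 6 T + 2 (T + 2 D)`. Zero row
  -- sums kill the bracket, and the normalisation gives `T = 2 m`.
  inSLˢ⇒traceSq≥ : ∀ {m} {A : Matrix (suc m)} → InSLˢ (path (suc m)) A → 0# ≤ traceSq A - fromℕ 6 * fromℕ m + fromℕ 4
  inSLˢ⇒traceSq≥ {m} {A} (sl , trace≈) = ≤-respʳ
    (begin
      S - fromℕ 4 * T + fromℕ 4 * D + fromℕ 6 * fromℕ m + fromℕ 4
        ≈⟨ solve 4 (λ S T D m → S :- :fromℕ 4 :* T :+ :fromℕ 4 :* D :+ :fromℕ 6 :* m :+ :fromℕ 4
             := S :- :fromℕ 6 :* T :+ :fromℕ 2 :* (T :+ :fromℕ 2 :* D) :+ :fromℕ 6 :* m :+ :fromℕ 4) refl S T D (fromℕ m) ⟩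
      S - fromℕ 6 * T + fromℕ 2 * (T + fromℕ 2 * D) + fromℕ 6 * fromℕ m + fromℕ 4
        ≈⟨ +-congʳ (+-congʳ (+-cong (+-congˡ (-‿cong (*-congˡ (trans trace≈ (fromℕ-double-size m))))) (*-congˡ total≈0))) ⟩
      S - fromℕ 6 * (fromℕ 2 * fromℕ m) + fromℕ 2 * 0# + fromℕ 6 * fromℕ m + fromℕ 4
        ≈⟨ solve 2 (λ S m → S :- :fromℕ 6 :* (:fromℕ 2 :* m) :+ :fromℕ 2 :* 0ᵖ :+ :fromℕ 6 :* m :+ :fromℕ 4
             := S :- :fromℕ 6 :* m :+ :fromℕ 4) refl S (fromℕ m) ⟩
      S - fromℕ 6 * fromℕ m + fromℕ 4 ∎)
    (traceSq-lower symmetric)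
    where
    open InSL sl
    S T D : Carrier
    S = traceSq A
    T = trace A
    D = superdiagonal A
    rowSum≈0 : ∀ i → sum (A i) ≈ 0#
    rowSum≈0 i = trans (sym (sum-except (A i) i)) (trans (+-congˡ (diagonal i)) (-‿inverseʳ _))
    total≈0 : T + fromℕ 2 * D ≈ 0#
    total≈0 = trans (sym (total-tridiagonal non-edge symmetric)) (sum-zero rowSum≈0)

  sumSq-shift : ∀ {n} (x : Vector Carrier n) c →
    ∑[ i < n ] ((x i - c) * (x i - c)) ≈ ∑[ i < n ] (x i * x i) - fromℕ 2 * c * sum x + fromℕ n * (c * c)
  sumSq-shift {zero}  x c = solve 1 (λ c → 0ᵖ := 0ᵖ :- :fromℕ 2 :* c :* 0ᵖ :+ 0ᵖ :* (c :* c)) refl c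
  sumSq-shift {suc n} x c = trans (+-congˡ (sumSq-shift (λ i → x (suc i)) c))
    (solve 5 (λ x c q s n →
        (x :- c) :* (x :- c) :+ (q :- :fromℕ 2 :* c :* s :+ n :* (c :* c))
        := x :* x :+ q :- :fromℕ 2 :* c :* (x :+ s) :+ (1ᵖ :+ n) :* (c :* c))
      refl (x zero) c (∑[ i < n ] (x (suc i) * x (suc i))) (∑[ i < n ] x (suc i)) (fromℕ n))

  -- The eigenvalue 0 in front contributes to neither power sum, so the trace fixes the mean of the
  -- remaining `m` values at 2; expanding the squares then leaves `traceSq A - 8 m + 4 m`.
  variance-path : ∀ {k} {A : Matrix (suc (suc k))} {v} → InSLˢ (path (suc (suc k))) A → IsVar A v →
    v ≈ fromℕ (suc k) ⁻¹ * (traceSq A - fromℕ 4 * fromℕ (suc k))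
  variance-path {k} {A} {v} (sl , trace≈) (λs , spectrum , v≈) = begin
    v
      ≈⟨ v≈ ⟩
    m ⁻¹ * ∑[ i < suc k ] ((λs i - mean λs) * (λs i - mean λs))
      ≈⟨ *-congˡ (sumSq-shift λs (mean λs)) ⟩
    m ⁻¹ * (Q - fromℕ 2 * mean λs * sum λs + m * (mean λs * mean λs))
      ≈⟨ *-congˡ (+-cong (+-cong Q≈ (-‿cong (*-cong (*-congˡ mean≈2) sum≈2m))) (*-congˡ (*-cong mean≈2 mean≈2))) ⟩
    m ⁻¹ * (traceSq A - fromℕ 2 * fromℕ 2 * (fromℕ 2 * m) + m * (fromℕ 2 * fromℕ 2))
      ≈⟨ *-congˡ (solve 2 (λ S m → S :- :fromℕ 2 :* :fromℕ 2 :* (:fromℕ 2 :* m) :+ m :* (:fromℕ 2 :* :fromℕ 2)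
           := S :- :fromℕ 4 :* m) refl (traceSq A) m) ⟩
    m ⁻¹ * (traceSq A - fromℕ 4 * m) ∎
    where
    open InSL sl
    m Q : Carrier
    m = fromℕ (suc k)
    Q = ∑[ i < suc k ] (λs i * λs i)
    Q≈ : Q ≈ traceSq A
    Q≈ = sym (trans (sumSq-spectrum non-edge (0# ∷ λs) spectrum) (trans (+-congʳ (zeroˡ 0#)) (+-identityˡ _)))
    sum≈2m : sum λs ≈ fromℕ 2 * m
    sum≈2m = begin
      sum λs                              ≈⟨ +-identityˡ _ ⟨
      0# + sum λs                         ≈⟨ sum-spectrum non-edge (0# ∷ λs) spectrum ⟨
      trace A                             ≈⟨ trace≈ ⟩
      fromℕ (2 ℕ.* size (path (2 ℕ.+ k))) ≈⟨ fromℕ-double-size (suc k) ⟩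
      fromℕ 2 * m                         ∎
    mean≈2 : mean λs ≈ fromℕ 2
    mean≈2 = begin
      m ⁻¹ * sum λs         ≈⟨ *-congˡ sum≈2m ⟩
      m ⁻¹ * (fromℕ 2 * m)  ≈⟨ solve 3 (λ i x m → i :* (x :* m) := m :* i :* x) refl (m ⁻¹) (fromℕ 2) m ⟩
      m * m ⁻¹ * fromℕ 2    ≈⟨ *-congʳ (0<⇒x*x⁻¹≈1 (0<fromℕ k)) ⟩
      1# * fromℕ 2          ≈⟨ *-identityˡ _ ⟩
      fromℕ 2               ∎

  variance-lower : ∀ {k} {A : Matrix (suc (suc k))} {v} → InSLˢ (path (suc (suc k))) A → IsVar A v →
    fromℕ 2 - fromℕ 4 * fromℕ (suc k) ⁻¹ ≤ v
  variance-lower {k} {A} {v} sl var = ≤-by (begin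
      v - (fromℕ 2 - fromℕ 4 * i)
        ≈⟨ +-cong (variance-path sl var) (-‿cong (+-congʳ (trans (sym (*-identityˡ _)) (*-congʳ (sym (0<⇒x*x⁻¹≈1 (0<fromℕ k))))))) ⟩
      i * (traceSq A - fromℕ 4 * m) - (m * i * fromℕ 2 - fromℕ 4 * i)
        ≈⟨ solve 3 (λ i S m → i :* (S :- :fromℕ 4 :* m) :- (m :* i :* :fromℕ 2 :- :fromℕ 4 :* i)
             := i :* (S :- :fromℕ 6 :* m :+ :fromℕ 4)) refl i (traceSq A) m ⟩
      i * (traceSq A - fromℕ 6 * m + fromℕ 4) ∎)
    (0≤x*y (<⇒≤ (0<x⁻¹ (0<fromℕ k))) (inSLˢ⇒traceSq≥ sl))
    where
    m i : Carrier
    m = fromℕ (suc k)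
    i = m ⁻¹

  -- The Laplacian of the path with unit weights, plus x in the first diagonal entry.
  laplacian : Carrier → ∀ m → Matrix (suc m)
  laplacian x zero    _             _             = x
  laplacian x (suc m) zero          zero          = 1# + x
  laplacian x (suc m) zero          (suc zero)    = - 1#
  laplacian x (suc m) zero          (suc (suc _)) = 0#
  laplacian x (suc m) (suc i)       (suc j)       = laplacian 1# m i j
  laplacian x (suc m) (suc zero)    zero          = - 1#
  laplacian x (suc m) (suc (suc _)) zero          = 0#

  laplacian-sym : ∀ x m i j → laplacian x m i j ≈ laplacian x m j i
  laplacian-sym x zero    _             _             = refl
  laplacian-sym x (suc m) zero          zero          = refl
  laplacian-sym x (suc m) zero          (suc zero)    = refl
  laplacian-sym x (suc m) zero          (suc (suc _)) = refl
  laplacian-sym x (suc m) (suc zero)    zero          = refl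
  laplacian-sym x (suc m) (suc (suc _)) zero          = refl
  laplacian-sym x (suc m) (suc i)       (suc j)       = laplacian-sym 1# m i j

  -1<0 : - 1# < 0#
  -1<0 = <-by (solve 0 (0ᵖ :- (:- 1ᵖ) := 1ᵖ) refl) 0<1

  laplacian-edge : ∀ x m i j → Adj (path (suc m)) i j → laplacian x m i j < 0#
  laplacian-edge x zero    zero          zero          (inj₁ ())
  laplacian-edge x zero    zero          zero          (inj₂ ())
  laplacian-edge x (suc m) zero          zero          (inj₁ ())
  laplacian-edge x (suc m) zero          zero          (inj₂ ())
  laplacian-edge x (suc m) zero          (suc zero)    _         = -1<0
  laplacian-edge x (suc m) zero          (suc (suc _)) (inj₁ ())
  laplacian-edge x (suc m) zero          (suc (suc _)) (inj₂ ())
  laplacian-edge x (suc m) (suc zero)    zero          _         = -1<0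
  laplacian-edge x (suc m) (suc (suc _)) zero          (inj₁ ())
  laplacian-edge x (suc m) (suc (suc _)) zero          (inj₂ ())
  laplacian-edge x (suc m) (suc i)       (suc j)       (inj₁ eq) = laplacian-edge 1# m i j (inj₁ (ℕ.suc-injective eq))
  laplacian-edge x (suc m) (suc i)       (suc j)       (inj₂ eq) = laplacian-edge 1# m i j (inj₂ (ℕ.suc-injective eq))

  laplacian-tridiagonal : ∀ x m → Tridiagonal (laplacian x m)
  laplacian-tridiagonal x zero    zero          zero          0≢0 _    = contradiction ≡.refl 0≢0
  laplacian-tridiagonal x (suc m) zero          zero          0≢0 _    = contradiction ≡.refl 0≢0
  laplacian-tridiagonal x (suc m) zero          (suc zero)    _   ¬adj = contradiction (inj₁ ≡.refl) ¬adj
  laplacian-tridiagonal x (suc m) zero          (suc (suc _)) _   _    = refl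
  laplacian-tridiagonal x (suc m) (suc zero)    zero          _   ¬adj = contradiction (inj₂ ≡.refl) ¬adj
  laplacian-tridiagonal x (suc m) (suc (suc _)) zero          _   _    = refl
  laplacian-tridiagonal x (suc m) (suc i)       (suc j)       i≢j ¬adj =
    laplacian-tridiagonal 1# m i j (λ i≡j → i≢j (≡.cong suc i≡j))
      λ { (inj₁ eq) → ¬adj (inj₁ (≡.cong suc eq)) ; (inj₂ eq) → ¬adj (inj₂ (≡.cong suc eq)) }

  laplacian-rowSum-zero : ∀ x m → sum (laplacian x m zero) ≈ x
  laplacian-rowSum-zero x zero    = +-identityʳ x
  laplacian-rowSum-zero x (suc m) = trans
    (+-congˡ (+-congˡ (sum-zero {n = m} {f = λ _ → 0#} λ _ → refl)))
    (solve 1 (λ x → 1ᵖ :+ x :+ (:- 1ᵖ :+ 0ᵖ) := x) refl x)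

  laplacian-rowSum-suc : ∀ x m i → sum (laplacian x m (suc i)) ≈ 0#
  laplacian-rowSum-suc x (suc m) zero    = trans (+-congˡ (laplacian-rowSum-zero 1# m)) (-‿inverseˡ 1#)
  laplacian-rowSum-suc x (suc m) (suc i) = trans (+-identityˡ _) (laplacian-rowSum-suc 1# m i)

  laplacian-trace : ∀ m → trace (laplacian 1# m) ≈ 1# + fromℕ 2 * fromℕ m
  laplacian-trace zero    = solve 0 (1ᵖ :+ 0ᵖ := 1ᵖ :+ :fromℕ 2 :* 0ᵖ) refl
  laplacian-trace (suc m) = trans (+-congˡ (laplacian-trace m))
    (solve 1 (λ m → 1ᵖ :+ 1ᵖ :+ (1ᵖ :+ :fromℕ 2 :* m) := 1ᵖ :+ :fromℕ 2 :* (1ᵖ :+ m)) refl (fromℕ m))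

  laplacian-traceSq : ∀ m → traceSq (laplacian 1# m) ≈ 1# + fromℕ 6 * fromℕ m
  laplacian-traceSq zero    = solve 0 (1ᵖ :* 1ᵖ := 1ᵖ :+ :fromℕ 6 :* 0ᵖ) refl
  laplacian-traceSq (suc m) = trans (+-congʳ (+-congʳ (laplacian-traceSq m)))
    (solve 1 (λ m → 1ᵖ :+ :fromℕ 6 :* m :+ (1ᵖ :+ 1ᵖ) :* (1ᵖ :+ 1ᵖ) :+ :fromℕ 2 :* ((:- 1ᵖ) :* (:- 1ᵖ))
       := 1ᵖ :+ :fromℕ 6 :* (1ᵖ :+ m)) refl (fromℕ m))

  laplacian-inSLˢ : ∀ k → InSLˢ (path (suc (suc k))) (laplacian 0# (suc k))
  laplacian-inSLˢ k = record
    { symmetric = laplacian-sym 0# m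
    ; edge      = laplacian-edge 0# m
    ; non-edge  = laplacian-tridiagonal 0# m
    ; diagonal  = λ i → begin
        laplacian 0# m i i                     ≈⟨ solve 2 (λ s a → a := :- s :+ (s :+ a)) refl (off i) (laplacian 0# m i i) ⟩
        - off i + (off i + laplacian 0# m i i) ≈⟨ +-congˡ (trans (sum-except (laplacian 0# m i) i) (rowSum i)) ⟩
        - off i + 0#                           ≈⟨ +-identityʳ _ ⟩
        - off i                                ∎
    } , (begin
      1# + 0# + trace (laplacian 1# k)      ≈⟨ +-congˡ (laplacian-trace k) ⟩
      1# + 0# + (1# + fromℕ 2 * fromℕ k)    ≈⟨ solve 1 (λ k → 1ᵖ :+ 0ᵖ :+ (1ᵖ :+ :fromℕ 2 :* k) := :fromℕ 2 :* (1ᵖ :+ k)) refl (fromℕ k) ⟩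
      fromℕ 2 * fromℕ m                     ≈⟨ fromℕ-double-size m ⟨
      fromℕ (2 ℕ.* size (path (suc m)))     ∎)
    where
    m : ℕ
    m = suc k
    off : Fin (suc m) → Carrier
    off i = ∑[ j < suc m ] (if does (j Fin.≟ i) then 0# else laplacian 0# m i j)
    rowSum : ∀ i → sum (laplacian 0# m i) ≈ 0#
    rowSum zero    = laplacian-rowSum-zero 0# m
    rowSum (suc i) = laplacian-rowSum-suc 0# m i

  mutual
    -- The Chebyshev polynomials of the second kind in (t - 2) / 2, preceded by 0.
    chebyshev : ℕ → Carrier → Carrier
    chebyshev zero    t = 1#
    chebyshev (suc m) t = (t - fromℕ 2) * chebyshev m t - 1# * chebyshev⁻ m t

    chebyshev⁻ : ℕ → Carrier → Carrier
    chebyshev⁻ zero    t = 0#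
    chebyshev⁻ (suc m) t = chebyshev m t

  -- The Jacobi matrix has diagonal 2 and off-diagonal products 1, with one row per edge. Up to
  -- signs it is `BᵀB` for the oriented incidence matrix `B`, while the Laplacian is `BBᵀ`; this is
  -- why the two spectra agree apart from 0.
  chebyshev-jacobi : ∀ m → Jacobi m (chebyshev m) (chebyshev⁻ m)
  chebyshev-jacobi zero    = empty (λ _ → refl) (λ _ → refl)
  chebyshev-jacobi (suc m) = extend (fromℕ 2) 1# 0<1 (chebyshev-jacobi m) (λ _ → refl)

  -- Without its first row and column the Laplacian has diagonal 2, ..., 2, 1. Compared with the
  -- matrix of `chebyshev m`, the last diagonal entry is smaller by 1, and this adds `chebyshev⁻ m`.
  charPoly-minor : ∀ m x t → charPoly (minor (laplacian x m)) t ≈ chebyshev m t + chebyshev⁻ m t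
  charPoly-minor zero x t = sym (+-identityʳ 1#)
  charPoly-minor (suc zero) x t = trans (charPoly-one (laplacian 1# 0) t)
    (solve 1 (λ t → (t :- 1ᵖ) :* 1ᵖ := (t :- :fromℕ 2) :* 1ᵖ :- 1ᵖ :* 0ᵖ :+ 1ᵖ) refl t)
  charPoly-minor (suc (suc m)) x t = begin
    charPoly (laplacian 1# (suc m)) t
      ≈⟨ charPoly-tridiagonal (laplacian-tridiagonal 1# (suc m)) t ⟩
    (t - (1# + 1#)) * charPoly (minor (laplacian 1# (suc m))) t - (- 1#) * (- 1#) * charPoly (minor (laplacian 1# m)) t
      ≈⟨ +-cong (*-congˡ (charPoly-minor (suc m) 1# t)) (-‿cong (*-congˡ (charPoly-minor m 1# t))) ⟩
    (t - (1# + 1#)) * (chebyshev (suc m) t + chebyshev m t) - (- 1#) * (- 1#) * (chebyshev m t + chebyshev⁻ m t)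
      ≈⟨ solve 3 (λ t u w → let c = (t :- :fromℕ 2) :* u :- 1ᵖ :* w in
           (t :- (1ᵖ :+ 1ᵖ)) :* (c :+ u) :- (:- 1ᵖ) :* (:- 1ᵖ) :* (u :+ w)
           := (t :- :fromℕ 2) :* c :- 1ᵖ :* u :+ c) refl t (chebyshev m t) (chebyshev⁻ m t) ⟩
    chebyshev (suc (suc m)) t + chebyshev (suc m) t ∎

  -- After expansion the lower terms combine, by the Chebyshev recurrence, into one more copy of
  -- `chebyshev (suc k)`, raising its factor from `t - 1` to `t`. That factor is the eigenvalue 0
  -- which `IsVar` lists first.
  charPoly-laplacian : ∀ k t → charPoly (laplacian 0# (suc k)) t ≈ t * chebyshev (suc k) t
  charPoly-laplacian k t = begin
    charPoly (laplacian 0# (suc k)) t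
      ≈⟨ charPoly-tridiagonal (laplacian-tridiagonal 0# (suc k)) t ⟩
    (t - (1# + 0#)) * charPoly (minor (laplacian 0# (suc k))) t - (- 1#) * (- 1#) * charPoly (minor (laplacian 1# k)) t
      ≈⟨ +-cong (*-congˡ (charPoly-minor (suc k) 0# t)) (-‿cong (*-congˡ (charPoly-minor k 1# t))) ⟩
    (t - (1# + 0#)) * (chebyshev (suc k) t + chebyshev k t) - (- 1#) * (- 1#) * (chebyshev k t + chebyshev⁻ k t)
      ≈⟨ solve 3 (λ t u w → let c = (t :- :fromℕ 2) :* u :- 1ᵖ :* w in
           (t :- (1ᵖ :+ 0ᵖ)) :* (c :+ u) :- (:- 1ᵖ) :* (:- 1ᵖ) :* (u :+ w)
           := t :* c) refl t (chebyshev k t) (chebyshev⁻ k t) ⟩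
    t * chebyshev (suc k) t ∎

  laplacian-spectrum : ∀ k → Σ[ λs ∈ Vector Carrier (suc k) ] IsSpectrum (laplacian 0# (suc k)) (0# ∷ λs)
  laplacian-spectrum k = proj₁ splits , λ t → begin
    charPoly (laplacian 0# (suc k)) t                   ≈⟨ charPoly-laplacian k t ⟩
    t * chebyshev (suc k) t                             ≈⟨ *-cong (solve 1 (λ t → t := t :- 0ᵖ) refl t) (proj₂ splits t) ⟩
    (t - 0#) * product (λ i → t - proj₁ splits i)       ∎
    where
    splits : Σ[ μ ∈ Vector Carrier (suc k) ] (∀ t → chebyshev (suc k) t ≈ product (λ i → t - μ i))
    splits = jacobi-splits (chebyshev-jacobi (suc k))

  Variances : ℕ → Carrier → Set
  Variances k v = Σ[ A ∈ Matrix (suc (suc k)) ] (InSLˢ (path (suc (suc k))) A × IsVar A v)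

  laplacian-variance : ∀ k → ∃[ v ] (Variances k v × v ≤ fromℕ 2)
  laplacian-variance k = v , (A , sl , var) , ≤-by (begin
      fromℕ 2 - v
        ≈⟨ +-cong (trans (sym (*-identityˡ _)) (*-congʳ (sym (0<⇒x*x⁻¹≈1 (0<fromℕ k)))))
             (-‿cong (trans (variance-path sl var) (*-congˡ (+-congʳ (+-congʳ (+-congʳ (laplacian-traceSq k))))))) ⟩
      m * i * fromℕ 2 - i * (1# + fromℕ 6 * fromℕ k + (1# + 0#) * (1# + 0#) + fromℕ 2 * ((- 1#) * (- 1#)) - fromℕ 4 * m)
        ≈⟨ solve 2 (λ k i →
             (1ᵖ :+ k) :* i :* :fromℕ 2 :- i :* (1ᵖ :+ :fromℕ 6 :* k :+ (1ᵖ :+ 0ᵖ) :* (1ᵖ :+ 0ᵖ)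
               :+ :fromℕ 2 :* ((:- 1ᵖ) :* (:- 1ᵖ)) :- :fromℕ 4 :* (1ᵖ :+ k))
             := :fromℕ 2 :* i) refl (fromℕ k) i ⟩
      fromℕ 2 * i ∎)
    (0≤x*y (0≤fromℕ 2) (<⇒≤ (0<x⁻¹ (0<fromℕ k))))
    where
    A : Matrix (suc (suc k))
    A = laplacian 0# (suc k)
    sl : InSLˢ (path (suc (suc k))) A
    sl = laplacian-inSLˢ k
    v m i : Carrier
    v = variance (proj₁ (laplacian-spectrum k))
    m = fromℕ (suc k)
    i = m ⁻¹
    var : IsVar A v
    var = proj₁ (laplacian-spectrum k) , proj₂ (laplacian-spectrum k) , refl

  variances-lower : ∀ k → LowerBound (Variances k) (fromℕ 2 - fromℕ 4 * fromℕ (suc k) ⁻¹)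
  variances-lower k v (A , sl , var) = variance-lower sl var

  mv-path : ∀ k → ∃[ m ] IsInfimum (Variances k) m
  mv-path k = infimum (Variances k) (proj₁ (laplacian-variance k) , proj₁ (proj₂ (laplacian-variance k)))
    (_ , variances-lower k)

  mv : ℕ → Carrier
  -- Placeholder values: for one vertex the variance would average over no eigenvalues, and a limit
  -- does not see the first two terms.
  mv zero          = 0#
  mv (suc zero)    = 0#
  mv (suc (suc k)) = proj₁ (mv-path k)

  lowerBound≤infimum : ∀ {P m b} → IsInfimum P m → LowerBound P b → b ≤ m
  lowerBound≤infimum {P} {m} {b} (_ , approached) lower = ≮⇒≥ λ m<b → beyond (approached b m<b)
    where
    beyond : ¬ (∃[ x ] (P x × x < b))
    beyond (x , Px , x<b) = ≤⇒≯ (lower x Px) x<b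

  fromℕ-mono : ∀ {m n} → m ℕ.≤ n → fromℕ m ≤ fromℕ n
  fromℕ-mono {n = n} ℕ.z≤n = 0≤fromℕ n
  fromℕ-mono (ℕ.s≤s {m} {n} m≤n) = ≤-by
    (solve 2 (λ m n → 1ᵖ :+ n :- (1ᵖ :+ m) := n :- m) refl (fromℕ m) (fromℕ n)) (≤⇒0≤- (fromℕ-mono m≤n))

  mv⟶2 : mv ⟶ fromℕ 2
  mv⟶2 ε 0<ε = eventually (archimedean ε 0<ε)
    where
    eventually : ∃[ n ] 1# < ε * fromℕ (suc n) →
                 ∃[ N ] (∀ n → N ℕ.≤ n → fromℕ 2 - ε < mv n × mv n < fromℕ 2 + ε)
    -- Beyond this threshold `n - 1 ≥ 4 (n₀ + 1)`, so `4 / (n - 1) ≤ 1 / (n₀ + 1) < ε`. It exceeds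
    -- 1, which leaves only `n ≥ 2` to treat.
    eventually (n₀ , 1<εn₀) = suc (4 ℕ.* suc n₀) , close
      where
      close : ∀ n → suc (4 ℕ.* suc n₀) ℕ.≤ n → fromℕ 2 - ε < mv n × mv n < fromℕ 2 + ε
      close (suc (suc k)) (ℕ.s≤s N≤m) = <-≤-trans 2-ε<2-4i (lowerBound≤infimum (proj₂ (mv-path k)) (variances-lower k))
        , ≤-<-trans (≤-trans (proj₁ (proj₂ (mv-path k)) _ (proj₁ (proj₂ (laplacian-variance k)))) (proj₂ (proj₂ (laplacian-variance k))))
            (<-by (solve 2 (λ x e → x :+ e :- x := e) refl (fromℕ 2) ε) 0<ε)
        where
        m i : Carrier
        m = fromℕ (suc k)
        i = m ⁻¹
        4n₀≤m : fromℕ 4 * fromℕ (suc n₀) ≤ m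
        4n₀≤m = ≤-respˡ (×1-homo-* 4 (suc n₀)) (fromℕ-mono N≤m)
        4<εm : fromℕ 4 < ε * m
        4<εm = <-by (solve 4 (λ f e n m → e :* m :- f := f :* (e :* n :- 1ᵖ) :+ e :* (m :- f :* n)) refl (fromℕ 4) ε (fromℕ (suc n₀)) m)
          (0<x+y (*-pos (0<fromℕ 3) (<⇒0<- 1<εn₀)) (0≤x*y (<⇒≤ 0<ε) (≤⇒0≤- 4n₀≤m)))
        2-ε<2-4i : fromℕ 2 - ε < fromℕ 2 - fromℕ 4 * i
        2-ε<2-4i = <-by (begin
          fromℕ 2 - fromℕ 4 * i - (fromℕ 2 - ε) ≈⟨ solve 4 (λ t f i e → t :- f :* i :- (t :- e) := e :* 1ᵖ :- f :* i) refl (fromℕ 2) (fromℕ 4) i ε ⟩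
          ε * 1# - fromℕ 4 * i                  ≈⟨ +-congʳ (*-congˡ (0<⇒x*x⁻¹≈1 (0<fromℕ k))) ⟨
          ε * (m * i) - fromℕ 4 * i             ≈⟨ solve 4 (λ e m i f → e :* (m :* i) :- f :* i := (e :* m :- f) :* i) refl ε m i (fromℕ 4) ⟩
          (ε * m - fromℕ 4) * i                 ∎)
          (*-pos (<⇒0<- 4<εm) (0<x⁻¹ (0<fromℕ k)))

open import Data.Nat.Base using (_+_)

theorem4p12 : (ℝ : CompleteOrderedField) →
    let open CompleteOrderedField ℝ using (Carrier)
        open OverReals ℝ
    in
    (∀ k → Eligible (path (2 + k))) ×
    (Σ[ mv ∈ (ℕ → Carrier) ]
      ((∀ k → IsMv (path (2 + k)) (mv (2 + k))) × (mv ⟶ fromℕ 2)))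
theorem4p12 ℝ = (λ k → eligible-path (suc k)) , mv , (λ k → proj₂ (mv-path k)) , mv⟶2
  where
  open PathEligible ℝ using (eligible-path)
  open PathVariance ℝ using (mv; mv-path; mv⟶2)
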